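{- Let $G=(K\uplus S,E)$ be a connected split graph and let $D_s,D_t$ be two D$2$DSs of $G$ of the same size $k$. Then (a) $M^\star_{\mathsf{TS}}(G,D_s,D_t)\le \mathrm{opt}_{\mathsf{TS}}(G,D_s,D_t)\le M^\star_{\mathsf{TS}}(G,D_s,D_t)+2$; (b) $M^\star_{\mathsf{TJ}}(G,D_s,D_t)\le \mathrm{opt}_{\mathsf{TJ}}(G,D_s,D_t)\le M^\star_{\mathsf{TJ}}(G,D_s,D_t)+1$. Moreover, there exist instances (a connected split graph $G$ and D$2$DSs $D_s,D_t$ of equal size) with $\mathrm{opt}_{\mathsf{TS}}(G,D_s,D_t)=M^\star_{\mathsf{TS}}(G,D_s,D_t)+2$, and instances with $\mathrm{opt}_{\mathsf{TJ}}(G,D_s,D_t)=M^\star_{\mathsf{TJ}}(G,D_s,D_t)+1$.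
   Context: Graphs are finite, simple, undirected and connected. A split graph $G=(K\uplus S,E)$ has vertex set partitioned into a clique $K$ and an independent set $S$. A D$2$DS of $G$ is a set $D\subseteq V(G)$ such that every vertex is at distance at most $2$ from some vertex of $D$. A $\mathsf{TJ}$-sequence between D$2$DSs $D_s,D_t$ is a sequence $D_s=D_0,\dots,D_q=D_t$ of D$2$DSs with $D_i\setminus D_{i+1}=\{x_i\}$, $D_{i+1}\setminus D_i=\{y_i\}$ for each $i$; a $\mathsf{TS}$-sequence additionally requires $x_iy_i\in E(G)$; its length is $q$. For $\mathsf{R}\in\{\mathsf{TS},\mathsf{TJ}\}$, $\mathrm{opt}_{\mathsf{R}}(G,D_s,D_t)$ is the minimum length of an $\mathsf{R}$-sequence between $D_s$ and $D_t$ ($\infty$ if none exists). With $D_s=\{s_1,\dots,s_k\}$, $M^\star_{\mathsf{TS}}(G,D_s,D_t)=\min_f\sum_{i=1}^k \mathrm{dist}_G(s_i,f(s_i))$ over all bijections $f:D_s\to D_t$, and $M^\star_{\mathsf{TJ}}(G,D_s,D_t)=|D_s\,\Delta\, D_t|/2$. -}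

module Defs where

open import Data.Bool using (Bool; true; false; T; if_then_else_)
open import Data.Nat using (ℕ; zero; suc; _+_; _≤_)
open import Data.Nat.DivMod using (_/_)
open import Data.Fin using (Fin)
open import Data.Fin.Subset using (Subset; _∈_; _∉_; _∪_; _─_; ∣_∣)
open import Data.Vec using (lookup)
open import Data.List using (List; map; allFin)
open import Data.Nat.ListAction using (sum)
open import Data.Unit using (⊤)
open import Data.Product using (Σ; _×_; ∃; ∃-syntax; _,_)
open import Relation.Nullary using (¬_)
open import Relation.Binary.PropositionalEquality using (_≡_)
open import Function.Bundles using (_⇔_)

record Graph (n : ℕ) : Set where
  field
    adj    : Fin n → Fin n → Bool
    irrefl : ∀ v → adj v v ≡ false
    sym    : ∀ u v → adj u v ≡ adj v u

open Graph public

Adj : ∀ {n} → Graph n → Fin n → Fin n → Set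
Adj G u v = T (adj G u v)

data Walk {n : ℕ} (G : Graph n) : Fin n → Fin n → ℕ → Set where
  here : ∀ {u} → Walk G u u 0
  step : ∀ {u w v ℓ} → Adj G u w → Walk G w v ℓ → Walk G u v (suc ℓ)

Connected : ∀ {n} → Graph n → Set
Connected G = ∀ u v → ∃[ ℓ ] Walk G u v ℓ

IsDistFn : ∀ {n} → Graph n → (Fin n → Fin n → ℕ) → Set
IsDistFn G d = ∀ u v → Walk G u v (d u v) × (∀ ℓ → Walk G u v ℓ → d u v ≤ ℓ)

IsSplit : ∀ {n} → Graph n → Set
IsSplit {n} G = Σ (Fin n → Bool) λ inK →
  (∀ u v → inK u ≡ true → inK v ≡ true → ¬ (u ≡ v) → Adj G u v) ×
  (∀ u v → inK u ≡ false → inK v ≡ false → ¬ Adj G u v)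

IsD2DS : ∀ {n} → Graph n → Subset n → Set
IsD2DS G D = ∀ v → ∃[ u ] (u ∈ D × ∃[ ℓ ] (ℓ ≤ 2 × Walk G u v ℓ))

data Rule : Set where
  TS TJ : Rule

RuleOK : ∀ {n} → Rule → Graph n → Fin n → Fin n → Set
RuleOK TS G x y = Adj G x y
RuleOK TJ G x y = ⊤

Step : ∀ {n} → Rule → Graph n → Subset n → Subset n → Set
Step {n} R G D D' = Σ (Fin n) λ x → Σ (Fin n) λ y →
  (x ∈ D × x ∉ D') × (y ∈ D' × y ∉ D) ×
  (∀ z → ¬ (z ≡ x) → ¬ (z ≡ y) → (z ∈ D ⇔ z ∈ D')) ×
  RuleOK R G x y

data Seq {n : ℕ} (R : Rule) (G : Graph n) : Subset n → Subset n → ℕ → Set where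
  done : ∀ {D} → IsD2DS G D → Seq R G D D 0
  cons : ∀ {D D' D'' q} → IsD2DS G D → Step R G D D' → Seq R G D' D'' q →
         Seq R G D D'' (suc q)

IsOpt : ∀ {n} → Rule → Graph n → Subset n → Subset n → ℕ → Set
IsOpt R G Ds Dt o = Seq R G Ds Dt o × (∀ q → Seq R G Ds Dt q → o ≤ q)

IsBij : ∀ {n} → Subset n → Subset n → (Fin n → Fin n) → Set
IsBij {n} Ds Dt g =
  (∀ v → v ∈ Ds → g v ∈ Dt) ×
  (∀ u v → u ∈ Ds → v ∈ Ds → g u ≡ g v → u ≡ v) ×
  (∀ w → w ∈ Dt → ∃[ v ] (v ∈ Ds × g v ≡ w))

cost : ∀ {n} → (Fin n → Fin n → ℕ) → Subset n → (Fin n → Fin n) → ℕ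
cost {n} d Ds g =
  sum (map (λ v → if lookup Ds v then d v (g v) else 0) (allFin n))

IsMStarTS : ∀ {n} → (Fin n → Fin n → ℕ) → Subset n → Subset n → ℕ → Set
IsMStarTS {n} d Ds Dt m =
  (Σ (Fin n → Fin n) λ g → IsBij Ds Dt g × cost d Ds g ≡ m) ×
  (∀ g → IsBij Ds Dt g → m ≤ cost d Ds g)

MStarTJ : ∀ {n} → Subset n → Subset n → ℕ
MStarTJ Ds Dt = ∣ (Ds ─ Dt) ∪ (Dt ─ Ds) ∣ / 2

{-# OPTIONS --safe #-}
module Submission where

-- A set that contains a clique vertex is a D2DS, so a sequence can only be obstructed when the last token on the clique
-- leaves it. If D_t contains a clique vertex b, an optimal matching tells which token goes to b, and these slides stay on
-- the clique, hence are free of charge; then b guards D_i. Any other token that still has to move offers a slide that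
-- lowers the cost of the matching and keeps a guard, unless its way is s – b – t with s, t ∈ S and b the only token
-- on the clique. When all remaining tokens are of this kind, the guard moves from b to another clique vertex c, they pass
-- over b, and the guard returns: two extra slides. (If b is the only clique vertex, every nonempty set is a D2DS.) If
-- D_t ⊆ S, one applies this with some target t of a token that has to move replaced by the vertex before t on its way.
-- For jumping, the exchanges never have to move a common clique vertex b, and one extra jump provides b if D_t ⊆ S.

open import Defs renaming (sym to adj-sym)
open import Data.Bool using (Bool; true; false; not; if_then_else_; _xor_; T; T?) renaming (_≟_ to _≟ᵇ_)
open import Data.Bool.Properties using (¬-not)
open import Data.Nat using (ℕ; zero; suc; _+_; _*_; _≤_; _<_; _≤?_; _≡ᵇ_; _<ᵇ_; z≤n; s≤s; s≤s⁻¹)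
open import Data.Nat.DivMod using (_/_; m*n/n≡m; /-monoˡ-≤)
open import Data.Nat.ListAction using (sum)
open import Data.Nat.Properties hiding (_≤?_) renaming (_≟_ to _≟ⁿ_)
open import Data.Nat.Tactic.RingSolver using (solve-∀)
open import Data.Fin using (Fin; zero; suc; finToFun; funToFin; toℕ; #_)
open import Data.Fin.Properties using (_≟_; any?; all?; finToFun-funToFin)
open import Data.Fin.Permutation.Components using (transpose; transpose-inverse)
open import Data.Fin.Subset using (Subset; inside; outside; _∈_; _∉_; _⊆_; _∪_; _─_; ∣_∣; ⁅_⁆)
open import Data.Fin.Subset.Properties using (_∈?_; ⊆-antisym; ∪-comm; p⊂q⇒∣p∣<∣q∣)
open import Data.List using (List; []; _∷_; map; allFin; tabulate)
open import Data.List.Properties using (map-tabulate; tabulate-cong)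
open import Data.Vec using (Vec; []; _∷_; lookup; here; there; _[_]≔_) renaming (map to mapᵛ)
open import Data.Vec.Functional using (updateAt)
open import Data.Vec.Functional.Properties using (updateAt-updates; updateAt-minimal)
open import Data.Vec.Properties using ([]=⇒lookup; lookup⇒[]=; lookup∘update; lookup∘update′; ≡-dec)
open import Data.List.Membership.Propositional using () renaming (_∈_ to _∈ᴸ_)
open import Data.List.Membership.Propositional.Properties using (∈-allFin)
open import Data.List.Relation.Unary.Any using (here; there)
open import Data.Product using (Σ; _×_; ∃-syntax; _,_; proj₁; proj₂)
open import Data.Sum using (_⊎_; inj₁; inj₂)
open import Data.Unit using (tt)
open import Function using (_∘_; const; id)
open import Function.Bundles using (_⇔_; mk⇔; Equivalence)
open import Relation.Nullary using (¬_; Dec; yes; no; contradiction)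
open import Relation.Nullary.Decidable using (_×-dec_; _→-dec_; ¬?; map′; decidable-stable; from-yes; from-no)
open import Relation.Unary using (Decidable)
open import Relation.Binary.PropositionalEquality

open Equivalence using (to; from)

private variable
  n q r : ℕ
  x y : Fin n
  D D' D'' Dt : Subset n
  f g : Fin n → Fin n
  R : Rule
  G : Graph n

-- Finite sums and membership bits.

Σᶠ : (Fin n → ℕ) → ℕ
Σᶠ {n} F = sum (map F (allFin n))

-- Each side adds the summand that the other sum has at `x`, which expresses the difference of the
-- sums without truncated subtraction.
Σᶠ-except : (F F' : Fin n → ℕ) (x : Fin n) → (∀ v → v ≢ x → F v ≡ F' v) →
            Σᶠ F + F' x ≡ Σᶠ F' + F x
Σᶠ-except F F' x eq
  rewrite map-tabulate id F | map-tabulate id F' = go F F' x eq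
  where
  rearrange : ∀ a b c → a + b + c ≡ c + b + a
  rearrange = solve-∀
  go : ∀ {n} (F F' : Fin n → ℕ) (x : Fin n) → (∀ v → v ≢ x → F v ≡ F' v) →
       sum (tabulate F) + F' x ≡ sum (tabulate F') + F x
  go F F' zero eq
    rewrite tabulate-cong {f = F ∘ suc} {g = F' ∘ suc} (λ v → eq (suc v) λ ())
    = rearrange (F zero) _ (F' zero)
  go F F' (suc x) eq
    rewrite eq zero (λ ()) | +-assoc (F' zero) (sum (tabulate (F ∘ suc))) (F' (suc x))
          | +-assoc (F' zero) (sum (tabulate (F' ∘ suc))) (F (suc x))
    = cong (F' zero +_) (go (F ∘ suc) (F' ∘ suc) x λ v v≢x → eq (suc v) λ { refl → v≢x refl })

Σᶠ-except₂ : (F F' : Fin n → ℕ) {x y : Fin n} → x ≢ y →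
             (∀ v → v ≢ x → v ≢ y → F v ≡ F' v) →
             Σᶠ F + (F' x + F' y) ≡ Σᶠ F' + (F x + F y)
Σᶠ-except₂ F F' {x} {y} x≢y eq =
  combine (Σᶠ F) (Σᶠ H) (Σᶠ F') (F x) (F y) (F' x) (F' y)
    (subst (λ z → Σᶠ F + z ≡ Σᶠ H + F x) Hx
      (Σᶠ-except F H x λ v v≢x → sym (updateAt-minimal v x F v≢x)))
    (subst (λ z → Σᶠ H + F' y ≡ Σᶠ F' + z) (updateAt-minimal y x F (x≢y ∘ sym))
      (Σᶠ-except H F' y H≡F'))
  where
  -- `H` interpolates: it differs from `F` only at `x` and from `F'` only at `y`, so the one-point
  -- version applies twice.
  H = updateAt F x (const (F' x))
  Hx : H x ≡ F' x
  Hx = updateAt-updates x F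
  H≡F' : ∀ v → v ≢ y → H v ≡ F' v
  H≡F' v v≢y with v ≟ x
  ... | yes refl = Hx
  ... | no v≢x = trans (updateAt-minimal v x F v≢x) (eq v v≢x v≢y)
  combine : ∀ a h b fx fy gx gy → a + gx ≡ h + fx → h + gy ≡ b + fy →
            a + (gx + gy) ≡ b + (fx + fy)
  combine a h b fx fy gx gy p q = begin
    a + (gx + gy) ≡⟨ sym (+-assoc a gx gy) ⟩
    a + gx + gy   ≡⟨ cong (_+ gy) p ⟩
    h + fx + gy   ≡⟨ trans (+-assoc h fx gy) (trans (cong (h +_) (+-comm fx gy)) (sym (+-assoc h gy fx))) ⟩
    h + gy + fx   ≡⟨ cong (_+ fx) q ⟩
    b + fy + fx   ≡⟨ trans (+-assoc b fy fx) (cong (b +_) (+-comm fy fx)) ⟩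
    b + (fx + fy) ∎
    where open ≡-Reasoning

Σᶠ-mono : (F F' : Fin n → ℕ) → (∀ v → F v ≤ F' v) → Σᶠ F ≤ Σᶠ F'
Σᶠ-mono {n} F F' le = go (allFin n)
  where
  go : ∀ xs → sum (map F xs) ≤ sum (map F' xs)
  go [] = z≤n
  go (x ∷ xs) = +-mono-≤ (le x) (go xs)

Σᶠ-cong : (F F' : Fin n → ℕ) → (∀ v → F v ≡ F' v) → Σᶠ F ≡ Σᶠ F'
Σᶠ-cong F F' eq = ≤-antisym (Σᶠ-mono F F' (≤-reflexive ∘ eq)) (Σᶠ-mono F' F (≤-reflexive ∘ sym ∘ eq))

∉⇒lookup : x ∉ D → lookup D x ≡ false
∉⇒lookup {x = x} {D = D} x∉D = ¬-not (x∉D ∘ lookup⇒[]= x D)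

∈⇔⇒lookup≡ : x ∈ D ⇔ x ∈ D' → lookup D x ≡ lookup D' x
∈⇔⇒lookup≡ {x = x} {D = D} e with x ∈? D
... | yes x∈D = trans ([]=⇒lookup x∈D) (sym ([]=⇒lookup (to e x∈D)))
... | no x∉D = trans (∉⇒lookup x∉D) (sym (∉⇒lookup (x∉D ∘ from e)))

-- Moves: the part of a reconfiguration step that does not depend on the rule.

Move : Subset n → Subset n → Fin n → Fin n → Set
Move D D' x y = (x ∈ D × x ∉ D') × (y ∈ D' × y ∉ D) ×
                (∀ z → ¬ (z ≡ x) → ¬ (z ≡ y) → (z ∈ D ⇔ z ∈ D'))

move : Subset n → Fin n → Fin n → Subset n
move D x y = D [ x ]≔ outside [ y ]≔ inside

∈∉⇒≢ : x ∈ D → y ∉ D → x ≢ y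
∈∉⇒≢ x∈D y∉D refl = y∉D x∈D

move-Move : x ∈ D → y ∉ D → Move D (move D x y) x y
move-Move {x = x} {D = D} {y = y} x∈D y∉D =
  (x∈D , x∉D') , (lookup⇒[]= y _ (lookup∘update y (D [ x ]≔ outside) inside) , y∉D) , rest
  where
  x≢y : x ≢ y
  x≢y = ∈∉⇒≢ x∈D y∉D
  x∉D' : x ∉ move D x y
  x∉D' x∈ with () ← trans (sym ([]=⇒lookup x∈))
    (trans (lookup∘update′ x≢y (D [ x ]≔ outside) inside) (lookup∘update x D outside))
  same : ∀ z → z ≢ x → z ≢ y → lookup (move D x y) z ≡ lookup D z
  same z z≢x z≢y = trans (lookup∘update′ z≢y (D [ x ]≔ outside) inside) (lookup∘update′ z≢x D outside)
  rest : ∀ z → z ≢ x → z ≢ y → z ∈ D ⇔ z ∈ move D x y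
  rest z z≢x z≢y = mk⇔
    (λ z∈ → lookup⇒[]= z _ (trans (same z z≢x z≢y) ([]=⇒lookup z∈)))
    (λ z∈ → lookup⇒[]= z _ (trans (sym (same z z≢x z≢y)) ([]=⇒lookup z∈)))

Move-sym : Move D D' x y → Move D' D y x
Move-sym ((x∈ , x∉) , (y∈ , y∉) , rest) =
  (y∈ , y∉) , (x∈ , x∉) , λ z z≢y z≢x → mk⇔ (from (rest z z≢x z≢y)) (to (rest z z≢x z≢y))

Move-≢ : Move D D' x y → x ≢ y
Move-≢ ((x∈ , _) , (_ , y∉) , _) = ∈∉⇒≢ x∈ y∉

Move-stay : ∀ {v} → Move D D' x y → v ∈ D → v ≢ x → v ∈ D'
Move-stay {v = v} ((x∈ , _) , (_ , y∉) , rest) v∈ v≢x = to (rest v v≢x (∈∉⇒≢ v∈ y∉)) v∈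

Move-unique : Move D D' x y → Move D D'' x y → D' ≡ D''
Move-unique m m' = ⊆-antisym (half m m') (half m' m)
  where
  half : ∀ {x y} → Move D D' x y → Move D D'' x y → D' ⊆ D''
  half {x = x} {y} m ((_ , x∉D'') , (y∈D'' , _) , rest'') {v} v∈ with v ≟ y
  ... | yes refl = y∈D''
  ... | no v≢y = Move-stay ((proj₁ (proj₁ m) , x∉D'') , (y∈D'' , proj₂ (proj₁ (proj₂ m))) , rest'')
                   (Move-stay (Move-sym m) v∈ v≢y) (∈∉⇒≢ v∈ (proj₂ (proj₁ m)))

Step⁺ : Move D D' x y → RuleOK R G x y → Step R G D D'
Step⁺ (a , b , c) ok = _ , _ , a , b , c , ok

snoc : Seq R G D D' q → Step R G D' D'' → IsD2DS G D'' → Seq R G D D'' (suc q)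
snoc (done ds) st ds'' = cons ds st (done ds'')
snoc (cons ds st s) st' ds'' = cons ds st (snoc s st' ds'')

-- Matchings and their cost.

infixl 6 _[_↦_]
_[_↦_] : (Fin n → Fin n) → Fin n → Fin n → Fin n → Fin n
f [ x ↦ y ] = updateAt f x (const y)

↦-here : (f : Fin n → Fin n) (x y : Fin n) → (f [ x ↦ y ]) x ≡ y
↦-here f x y = updateAt-updates x f

↦-there : (f : Fin n → Fin n) {x v : Fin n} (y : Fin n) → v ≢ x → (f [ x ↦ y ]) v ≡ f v
↦-there f {x} {v} y v≢x = updateAt-minimal v x f v≢x

IsBij-id : IsBij D D id
IsBij-id = (λ _ → id) , (λ _ _ _ _ → id) , λ w w∈ → w , w∈ , refl

IsBij-cong : (∀ v → f v ≡ g v) → IsBij D Dt f → IsBij D Dt g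
IsBij-cong {Dt = Dt} eq (into , inj , onto) =
  (λ v v∈ → subst (_∈ Dt) (eq v) (into v v∈)) ,
  (λ u v u∈ v∈ e → inj u v u∈ v∈ (trans (eq u) (trans e (sym (eq v))))) ,
  λ w w∈ → let (v , v∈ , e) = onto w w∈ in v , v∈ , trans (sym (eq v)) e

-- The token that went from `x` to `y` keeps its target `f x`; as `y` was free, the update at `y`
-- disturbs no other token.
IsBij-move : Move D D' x y → IsBij D Dt f → IsBij D' Dt (f [ y ↦ f x ])
IsBij-move {D = D} {D' = D'} {x = x} {y = y} {Dt = Dt} {f = f}
  m@((x∈ , x∉) , (y∈ , y∉) , rest) (into , inj , onto) = into' , inj' , onto'
  where
  f' = f [ y ↦ f x ]
  back : ∀ v → v ∈ D' → v ≢ y → v ∈ D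
  back v = Move-stay (Move-sym m)
  into' : ∀ v → v ∈ D' → f' v ∈ Dt
  into' v v∈ with v ≟ y
  ... | yes refl = subst (_∈ Dt) (sym (↦-here f y (f x))) (into x x∈)
  ... | no v≢y = subst (_∈ Dt) (sym (↦-there f (f x) v≢y)) (into v (back v v∈ v≢y))
  clash : ∀ v → v ∈ D' → v ≢ y → f x ≢ f' v
  clash v v∈ v≢y e = x∉ (subst (_∈ D') (sym (inj x v x∈ (back v v∈ v≢y) (trans e (↦-there f (f x) v≢y)))) v∈)
  inj' : ∀ u v → u ∈ D' → v ∈ D' → f' u ≡ f' v → u ≡ v
  inj' u v u∈ v∈ e with u ≟ y | v ≟ y
  ... | yes refl | yes refl = refl
  ... | yes refl | no v≢y = contradiction (trans (sym (↦-here f y (f x))) e) (clash v v∈ v≢y)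
  ... | no u≢y | yes refl = contradiction (trans (sym (↦-here f y (f x))) (sym e)) (clash u u∈ u≢y)
  ... | no u≢y | no v≢y = inj u v (back u u∈ u≢y) (back v v∈ v≢y)
    (trans (sym (↦-there f (f x) u≢y)) (trans e (↦-there f (f x) v≢y)))
  onto' : ∀ w → w ∈ Dt → ∃[ v ] (v ∈ D' × f' v ≡ w)
  onto' w w∈ with onto w w∈
  ... | v , v∈ , e with v ≟ x
  ... | yes refl = y , y∈ , trans (↦-here f y (f x)) e
  ... | no v≢x = v , Move-stay m v∈ v≢x , trans (↦-there f (f x) (∈∉⇒≢ v∈ y∉)) e

-- This serves target sets inside the independent set: one target `t` is traded for a clique vertex
-- `x`, and the token `u` that was heading for `t` now heads for `x`.
IsBij-retarget : ∀ {u t} → Move Dt D' t x → IsBij D Dt f → u ∈ D → f u ≡ t →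
                 IsBij D D' (f [ u ↦ x ])
IsBij-retarget {Dt = Dt} {D' = D'} {x = x} {D = D} {f = f} {u = u}
  m@((t∈ , t∉) , (x∈ , x∉) , rest) (into , inj , onto) u∈ refl = into' , inj' , onto'
  where
  f' = f [ u ↦ x ]
  into' : ∀ v → v ∈ D → f' v ∈ D'
  into' v v∈ with v ≟ u
  ... | yes refl = subst (_∈ D') (sym (↦-here f u x)) x∈
  ... | no v≢u = subst (_∈ D') (sym (↦-there f x v≢u))
                   (Move-stay m (into v v∈) (v≢u ∘ inj v u v∈ u∈))
  clash : ∀ v → v ∈ D → v ≢ u → x ≢ f' v
  clash v v∈ v≢u e = x∉ (subst (_∈ Dt) (sym (trans e (↦-there f x v≢u))) (into v v∈))
  inj' : ∀ v w → v ∈ D → w ∈ D → f' v ≡ f' w → v ≡ w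
  inj' v w v∈ w∈ e with v ≟ u | w ≟ u
  ... | yes refl | yes refl = refl
  ... | yes refl | no w≢u = contradiction (trans (sym (↦-here f u x)) e) (clash w w∈ w≢u)
  ... | no v≢u | yes refl = contradiction (trans (sym (↦-here f u x)) (sym e)) (clash v v∈ v≢u)
  ... | no v≢u | no w≢u = inj v w v∈ w∈ (trans (sym (↦-there f x v≢u)) (trans e (↦-there f x w≢u)))
  onto' : ∀ w → w ∈ D' → ∃[ v ] (v ∈ D × f' v ≡ w)
  onto' w w∈ with w ≟ x
  ... | yes refl = u , u∈ , ↦-here f u x
  ... | no w≢x with onto w (Move-stay (Move-sym m) w∈ w≢x)
  ... | v , v∈ , refl = v , v∈ , ↦-there f x λ { refl → t∉ w∈ }

transpose-ˡ : (u w : Fin n) → transpose u w u ≡ w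
transpose-ˡ u w with u ≟ u
... | yes _ = refl
... | no u≢u = contradiction refl u≢u

transpose-ʳ : (u w : Fin n) → transpose u w w ≡ u
transpose-ʳ u w with w ≟ u
... | yes e = e
... | no _ with w ≟ w
... | yes _ = refl
... | no w≢w = contradiction refl w≢w

transpose-≢ : (u w : Fin n) {v : Fin n} → v ≢ u → v ≢ w → transpose u w v ≡ v
transpose-≢ u w {v} v≢u v≢w with v ≟ u
... | yes e = contradiction e v≢u
... | no _ with v ≟ w
... | yes e = contradiction e v≢w
... | no _ = refl

-- Precomposing with the transposition exchanges the targets of the tokens `u` and `w`.
IsBij-transpose : ∀ {u w} → u ∈ D → w ∈ D → IsBij D Dt f → IsBij D Dt (f ∘ transpose u w)
IsBij-transpose {D = D} {Dt = Dt} {f = f} {u = u} {w} u∈ w∈ (into , inj , onto) =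
  (λ v v∈ → into _ (stays u∈ w∈ v v∈)) ,
  (λ v v' v∈ v'∈ e → trans (sym (transpose-inverse w u)) (trans
     (cong (transpose w u) (inj _ _ (stays u∈ w∈ v v∈) (stays u∈ w∈ v' v'∈) e)) (transpose-inverse w u))) ,
  λ t t∈ → let (v , v∈ , e) = onto t t∈ in
    transpose w u v , stays w∈ u∈ v v∈ , trans (cong f (transpose-inverse u w)) e
  where
  stays : ∀ {u w} → u ∈ D → w ∈ D → ∀ v → v ∈ D → transpose u w v ∈ D
  stays {u} {w} u∈ w∈ v v∈ with v ≟ u
  ... | yes _ = w∈
  ... | no _ with v ≟ w
  ... | yes _ = u∈
  ... | no _ = v∈

module _ (d : Fin n → Fin n → ℕ) where

  private
    term : Subset n → (Fin n → Fin n) → Fin n → ℕ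
    term D f v = if lookup D v then d v (f v) else 0

    term-∈ : ∀ {D v} f → v ∈ D → term D f v ≡ d v (f v)
    term-∈ f v∈ rewrite []=⇒lookup v∈ = refl

    term-∉ : ∀ {D v} f → v ∉ D → term D f v ≡ 0
    term-∉ f v∉ rewrite ∉⇒lookup v∉ = refl

  cost-cong : ∀ {D f g} → (∀ v → f v ≡ g v) → cost d D f ≡ cost d D g
  cost-cong {D} {f} {g} eq = Σᶠ-cong (term D f) (term D g)
    λ v → cong (λ w → if lookup D v then d v w else 0) (eq v)

  cost-fixed : ∀ {D f} → (∀ v → v ∈ D → d v (f v) ≡ 0) → cost d D f ≡ 0
  cost-fixed {D} {f} eq = trans (Σᶠ-cong (term D f) (const 0) zeros) (sum0 (allFin n))
    where
    zeros : ∀ v → term D f v ≡ 0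
    zeros v with v ∈? D
    ... | yes v∈ = trans (term-∈ f v∈) (eq v v∈)
    ... | no v∉ = term-∉ f v∉
    sum0 : ∀ (xs : List (Fin n)) → sum (map (const 0) xs) ≡ 0
    sum0 [] = refl
    sum0 (_ ∷ xs) = sum0 xs

  -- Only the terms at `x` and `y` change: the token leaves `x` with its old distance and appears at
  -- `y` with target `t`.
  cost-move : ∀ {D D' x y} f t → Move D D' x y →
              cost d D' (f [ y ↦ t ]) + d x (f x) ≡ cost d D f + d y t
  cost-move {D} {D'} {x} {y} f t m@((x∈ , x∉) , (y∈ , y∉) , rest) =
    subst₂ _≡_ (cong (cost d D' f' +_) left) (cong (cost d D f +_) right)
      (Σᶠ-except₂ (term D' f') (term D f) (Move-≢ m) same)
    where
    f' = f [ y ↦ t ]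
    left : term D f x + term D f y ≡ d x (f x)
    left rewrite term-∈ f x∈ | term-∉ f y∉ = +-identityʳ _
    right : term D' f' x + term D' f' y ≡ d y t
    right rewrite term-∈ f' y∈ | term-∉ f' x∉ | ↦-here f y t = refl
    same : ∀ v → v ≢ x → v ≢ y → term D' f' v ≡ term D f v
    same v v≢x v≢y rewrite ∈⇔⇒lookup≡ (rest v v≢x v≢y) | ↦-there f t v≢y = refl

  cost-agree₂ : ∀ {D u w} f f' → u ∈ D → w ∈ D → u ≢ w →
                (∀ v → v ≢ u → v ≢ w → f' v ≡ f v) →
                cost d D f' + (d u (f u) + d w (f w)) ≡ cost d D f + (d u (f' u) + d w (f' w))
  cost-agree₂ {D} {u} {w} f f' u∈ w∈ u≢w same
    with e ← Σᶠ-except₂ (term D f') (term D f) u≢w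
           (λ v v≢u v≢w → cong (λ t → if lookup D v then d v t else 0) (same v v≢u v≢w))
    rewrite term-∈ f u∈ | term-∈ f w∈ | term-∈ f' u∈ | term-∈ f' w∈ = e

  cost-update : ∀ {D u} f t → u ∈ D → cost d D (f [ u ↦ t ]) + d u (f u) ≡ cost d D f + d u t
  cost-update {D} {u} f t u∈
    with e ← Σᶠ-except (term D (f [ u ↦ t ])) (term D f) u
           (λ v v≢u → cong (λ w → if lookup D v then d v w else 0) (↦-there f t v≢u))
    rewrite term-∈ f u∈ | term-∈ (f [ u ↦ t ]) u∈ | ↦-here f u t = e

-- Minima by exhaustive search.

least : {P : ℕ → Set} → Decidable P → ∀ m → P m → ∃[ o ] (P o × (∀ q → P q → o ≤ q))
least P? zero p = 0 , p , λ _ _ → z≤n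
least P? (suc m) p with P? 0
... | yes p₀ = 0 , p₀ , λ _ _ → z≤n
... | no ¬p₀ with o , po , min ← least (P? ∘ suc) m p =
  suc o , po , λ { zero p₀ → contradiction p₀ ¬p₀ ; (suc q) pq → s≤s (min q pq) }

Walk? : (G : Graph n) → ∀ u v ℓ → Dec (Walk G u v ℓ)
Walk? G u v zero = map′ (λ { refl → here }) (λ { here → refl }) (u ≟ v)
Walk? G u v (suc ℓ) = map′ (λ { (w , a , p) → step a p }) (λ { (step a p) → _ , a , p })
  (any? λ w → T? (adj G u w) ×-dec Walk? G w v ℓ)

IsD2DS? : (G : Graph n) (D : Subset n) → Dec (IsD2DS G D)
IsD2DS? G D = all? λ v → any? λ u → u ∈? D ×-dec
  map′ (λ { (ℓ , ℓ<3 , p) → ℓ , s≤s⁻¹ ℓ<3 , p }) (λ { (ℓ , ℓ≤2 , p) → ℓ , s≤s ℓ≤2 , p })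
    (anyUpTo? (Walk? G u v) 3)

RuleOK? : ∀ R (G : Graph n) x y → Dec (RuleOK R G x y)
RuleOK? TS G x y = T? (adj G x y)
RuleOK? TJ G x y = yes tt

-- A step is determined by the vertex left and the vertex entered, so for a fixed length it suffices
-- to search over pairs of vertices.
Seq? : ∀ R (G : Graph n) D D' q → Dec (Seq R G D D' q)
Seq? R G D D' zero = map′ (λ { (refl , ds) → done ds }) (λ { (done ds) → refl , ds })
  (≡-dec _≟ᵇ_ D D' ×-dec IsD2DS? G D)
Seq? R G D D'' (suc q) = map′
  (λ { (x , y , x∈ , y∉ , ok , s , ds) → cons ds (Step⁺ {R = R} {G = G} (move-Move x∈ y∉) ok) s })
  (λ { (cons ds (x , y , a@(x∈ , _) , b@(_ , y∉) , c , ok) s) → x , y , x∈ , y∉ , ok ,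
       -- The set reached by an arbitrary step coincides with the canonical `move D x y` that the
       -- search inspects.
       subst (λ D' → Seq R G D' D'' q) (Move-unique (a , b , c) (move-Move x∈ y∉)) s , ds })
  (any? λ x → any? λ y → x ∈? D ×-dec ¬? (y ∈? D) ×-dec RuleOK? R G x y ×-dec
     Seq? R G (move D x y) D'' q ×-dec IsD2DS? G D)

IsOpt-exists : Seq R G D D' q → ∃[ o ] IsOpt R G D D' o
IsOpt-exists {q = q} s = least (Seq? _ _ _ _) q s

IsBij? : (D D' : Subset n) (f : Fin n → Fin n) → Dec (IsBij D D' f)
IsBij? D D' f =
  (all? λ v → v ∈? D →-dec f v ∈? D') ×-dec
  (all? λ u → all? λ v → u ∈? D →-dec (v ∈? D →-dec (f u ≟ f v →-dec u ≟ v))) ×-dec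
  (all? λ w → w ∈? D' →-dec any? λ v → v ∈? D ×-dec f v ≟ w)

IsMStarTS-exists : (d : Fin n → Fin n → ℕ) → IsBij D D' f → ∃[ m ] IsMStarTS d D D' m
IsMStarTS-exists {n} {D} {D'} {f} d bij with
  least {λ m → ∃[ g ] (IsBij D D' g × cost d D g ≡ m)} attained? (cost d D f) (f , bij , refl)
  where
  attained? : ∀ m → Dec (∃[ g ] (IsBij D D' g × cost d D g ≡ m))
  attained? m = map′
    (λ { (i , p) → finToFun i , p })
    -- Functions are enumerated through their codes in a finite type. Decoding returns `g` only
    -- pointwise, hence the two congruence lemmas.
    (λ { (g , bij , c) → let eq = finToFun-funToFin g in
         funToFin g , IsBij-cong (sym ∘ eq) bij , trans (cost-cong d {D} eq) c })
    (any? λ i → IsBij? D D' (finToFun {n} i) ×-dec cost d D (finToFun i) ≟ⁿ m)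
... | m , attained , min = m , attained , λ g bij → min (cost d D g) (g , bij , refl)

-- Symmetric differences and exchanges.

symdiff : Subset n → Subset n → ℕ
symdiff D D' = ∣ (D ─ D') ∪ (D' ─ D) ∣

bit : Bool → ℕ
bit b = if b then 1 else 0

bit≤1 : ∀ b → bit b ≤ 1
bit≤1 true = ≤-refl
bit≤1 false = z≤n

∣∣-Σᶠ : (D : Subset n) → ∣ D ∣ ≡ Σᶠ (bit ∘ lookup D)
∣∣-Σᶠ {n} D rewrite map-tabulate {n = n} id (bit ∘ lookup D) = go D
  where
  go : ∀ {n} (D : Subset n) → ∣ D ∣ ≡ sum (tabulate (bit ∘ lookup D))
  go [] = refl
  go (true ∷ D) = cong suc (go D)
  go (false ∷ D) = go D

lookup-symdiff : (D D' : Subset n) → ∀ v →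
                 lookup ((D ─ D') ∪ (D' ─ D)) v ≡ lookup D v xor lookup D' v
lookup-symdiff (true ∷ _) (true ∷ _) zero = refl
lookup-symdiff (true ∷ _) (false ∷ _) zero = refl
lookup-symdiff (false ∷ _) (true ∷ _) zero = refl
lookup-symdiff (false ∷ _) (false ∷ _) zero = refl
lookup-symdiff (true ∷ D) (true ∷ D') (suc v) = lookup-symdiff D D' v
lookup-symdiff (true ∷ D) (false ∷ D') (suc v) = lookup-symdiff D D' v
lookup-symdiff (false ∷ D) (true ∷ D') (suc v) = lookup-symdiff D D' v
lookup-symdiff (false ∷ D) (false ∷ D') (suc v) = lookup-symdiff D D' v

symdiff-Σᶠ : (D D' : Subset n) → symdiff D D' ≡ Σᶠ (λ v → bit (lookup D v xor lookup D' v))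
symdiff-Σᶠ D D' = trans (∣∣-Σᶠ ((D ─ D') ∪ (D' ─ D)))
  (Σᶠ-cong (bit ∘ lookup ((D ─ D') ∪ (D' ─ D))) _ (cong bit ∘ lookup-symdiff D D'))

∣∣-Move : Move D D' x y → ∣ D' ∣ ≡ ∣ D ∣
∣∣-Move {D = D} {D' = D'} {x = x} {y = y} m@((x∈ , x∉) , (y∈ , y∉) , rest)
  with e ← Σᶠ-except₂ (bit ∘ lookup D') (bit ∘ lookup D) (Move-≢ m)
             (λ v v≢x v≢y → cong bit (sym (∈⇔⇒lookup≡ (rest v v≢x v≢y))))
  rewrite ∣∣-Σᶠ D | ∣∣-Σᶠ D' | []=⇒lookup x∈ | []=⇒lookup y∈ | ∉⇒lookup x∉ | ∉⇒lookup y∉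
  = +-cancelʳ-≡ 1 _ _ e

-- Both sides are moved so that no subtraction occurs.
symdiff-Move : ∀ {T} → Move D D' x y →
  symdiff D' T + (bit (not (lookup T x)) + bit (lookup T y)) ≡
  symdiff D T + (bit (lookup T x) + bit (not (lookup T y)))
symdiff-Move {D = D} {D' = D'} {x = x} {y = y} {T = T} m@((x∈ , x∉) , (y∈ , y∉) , rest)
  with e ← Σᶠ-except₂ (λ v → bit (lookup D' v xor lookup T v)) (λ v → bit (lookup D v xor lookup T v)) (Move-≢ m)
             (λ v v≢x v≢y → cong (λ b → bit (b xor lookup T v)) (sym (∈⇔⇒lookup≡ (rest v v≢x v≢y))))
  rewrite symdiff-Σᶠ D T | symdiff-Σᶠ D' T | []=⇒lookup x∈ | []=⇒lookup y∈ | ∉⇒lookup x∉ | ∉⇒lookup y∉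
  = e

symdiff-comm : (D D' : Subset n) → symdiff D D' ≡ symdiff D' D
symdiff-comm D D' = cong ∣_∣ (∪-comm (D ─ D') (D' ─ D))

symdiff-self : (D : Subset n) → symdiff D D ≡ 0
symdiff-self [] = refl
symdiff-self (true ∷ D) = symdiff-self D
symdiff-self (false ∷ D) = symdiff-self D

private
  cancel-2 : ∀ a b p q → p ≤ 2 → a + q ≡ b + p → a ≤ 2 + b
  cancel-2 a b p q p≤2 e = ≤-trans (m≤m+n a q) (≤-trans (≤-reflexive e)
    (≤-trans (+-monoʳ-≤ b p≤2) (≤-reflexive (+-comm b 2))))

-- A jump alters membership at two vertices and so lowers the symmetric difference with the target
-- by at most 2. This is the lower bound for token jumping.
symdiff-Seq : Seq TJ G D D' q → symdiff D D' ≤ q * 2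
symdiff-Seq {D = D} (done _) = ≤-reflexive (symdiff-self D)
symdiff-Seq {D = D} {D' = T} {q = suc q} (cons {D' = D'} _ (x , y , a , b , c , _) s) =
  ≤-trans (cancel-2 _ (symdiff D' T) _ _ (+-mono-≤ (bit≤1 (not (lookup T x))) (bit≤1 (lookup T y)))
             (sym (symdiff-Move {T = T} (a , b , c))))
          (+-monoʳ-≤ 2 (symdiff-Seq s))

-- Equal cardinalities rule out a strict inclusion in either direction.
equal-or-exchange : (D T : Subset n) → ∣ D ∣ ≡ ∣ T ∣ →
                    D ≡ T ⊎ (∃[ x ] (x ∈ D × x ∉ T)) × (∃[ y ] (y ∈ T × y ∉ D))
equal-or-exchange D T card with any? (λ x → x ∈? D ×-dec ¬? (x ∈? T))
                              | any? (λ y → y ∈? T ×-dec ¬? (y ∈? D))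
... | yes p | yes q = inj₂ (p , q)
... | yes (x , x∈ , x∉) | no T⊆D = contradiction (sym card)
      (<⇒≢ (p⊂q⇒∣p∣<∣q∣ ((λ {v} v∈ → decidable-stable (v ∈? D) λ v∉ → T⊆D (v , v∈ , v∉)) , x , x∈ , x∉)))
... | no D⊆T | yes (y , y∈ , y∉) = contradiction card
      (<⇒≢ (p⊂q⇒∣p∣<∣q∣ ((λ {v} v∈ → decidable-stable (v ∈? T) λ v∉ → D⊆T (v , v∈ , v∉)) , y , y∈ , y∉)))
... | no D⊆T | no T⊆D = inj₁ (⊆-antisym
      (λ {v} v∈ → decidable-stable (v ∈? T) λ v∉ → D⊆T (v , v∈ , v∉))
      (λ {v} v∈ → decidable-stable (v ∈? D) λ v∉ → T⊆D (v , v∈ , v∉)))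

data Exchange {n : ℕ} (T : Subset n) : Subset n → ℕ → Set where
  nil  : Exchange T T 0
  swap : Move D D' x y → x ∉ T → y ∈ T → Exchange T D' r → Exchange T D (suc r)

symdiff-exchange : ∀ {T} → Move D D' x y → x ∉ T → y ∈ T → symdiff D T ≡ 2 + symdiff D' T
symdiff-exchange {D = D} {D' = D'} {T = T} m x∉ y∈ with e ← symdiff-Move {T = T} m
  rewrite ∉⇒lookup x∉ | []=⇒lookup y∈ = trans (sym (+-identityʳ _)) (trans (sym e) (+-comm (symdiff D' T) 2))

symdiff-Exchange : ∀ {T} → Exchange T D r → symdiff D T ≡ r * 2
symdiff-Exchange {T = T} nil = symdiff-self T
symdiff-Exchange {T = T} (swap m x∉ y∈ e) =
  trans (symdiff-exchange m x∉ y∈) (cong (2 +_) (symdiff-Exchange e))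

Exchange-exists : (D T : Subset n) → ∣ D ∣ ≡ ∣ T ∣ → ∃[ r ] Exchange T D r
Exchange-exists D T card = go (symdiff D T) D card ≤-refl
  where
  -- `k` is fuel: the symmetric difference drops by 2 with each exchange, while one unit of fuel is
  -- spent.
  go : ∀ k D → ∣ D ∣ ≡ ∣ T ∣ → symdiff D T ≤ k → ∃[ r ] Exchange T D r
  go k D card le with equal-or-exchange D T card
  ... | inj₁ refl = 0 , nil
  ... | inj₂ ((x , x∈ , x∉) , (y , y∈ , y∉)) with m ← move-Move x∈ y∉
      with k | subst (_≤ k) (symdiff-exchange m x∉ y∈) le
  ... | suc k' | s≤s le' with r , e ← go k' _ (trans (∣∣-Move m) card) (≤-trans (n≤1+n _) le') =
    suc r , swap m x∉ y∈ e

MStarTJ-Exchange : ∀ {T} → Exchange T D r → MStarTJ D T ≡ r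
MStarTJ-Exchange {r = r} e = trans (cong (_/ 2) (symdiff-Exchange e)) (m*n/n≡m r 2)

-- The identity of `T` is transported backwards along an exchange sequence from `D` to `T`.
IsBij-exists : (D T : Subset n) → ∣ D ∣ ≡ ∣ T ∣ → ∃[ f ] IsBij D T f
IsBij-exists D T card = go (proj₂ (Exchange-exists D T card))
  where
  go : ∀ {D r} → Exchange T D r → ∃[ f ] IsBij D T f
  go nil = id , IsBij-id
  go (swap m _ _ e) = let (f , bij) = go e in _ , IsBij-move (Move-sym m) bij

-- Walks, distances, and the improvement of matchings along geodesics.

module _ (G : Graph n) where

  Adj-sym : Adj G x y → Adj G y x
  Adj-sym {x} {y} = subst T (adj-sym G x y)

  walk-++ : ∀ {u v w k ℓ} → Walk G u v k → Walk G v w ℓ → Walk G u w (k + ℓ)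
  walk-++ here p = p
  walk-++ (step a p') p = step a (walk-++ p' p)

  walk-last : ∀ {u v ℓ} → Walk G u v (suc ℓ) → ∃[ w ] (Walk G u w ℓ × Adj G w v)
  walk-last (step a here) = _ , here , a
  walk-last (step a p@(step _ _)) = let (w , p' , a') = walk-last p in w , step a p' , a'

module Distance {G : Graph n} {d : Fin n → Fin n → ℕ} (isd : IsDistFn G d) where

  geodesic : ∀ u v → Walk G u v (d u v)
  geodesic u v = proj₁ (isd u v)

  d-≤ : ∀ {u v ℓ} → Walk G u v ℓ → d u v ≤ ℓ
  d-≤ = proj₂ (isd _ _) _

  d-self : ∀ v → d v v ≡ 0
  d-self v = n≤0⇒n≡0 (d-≤ here)

  d-triangle : ∀ u v w → d u w ≤ d u v + d v w
  d-triangle u v w = d-≤ (walk-++ G (geodesic u v) (geodesic v w))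

  d-Adj : ∀ {u v} w → Adj G u v → d u w ≤ suc (d v w)
  d-Adj w a = d-≤ (step a (geodesic _ w))

  d-pos : ∀ {u v} → u ≢ v → 1 ≤ d u v
  d-pos {u} {v} u≢v with d u v | geodesic u v
  ... | zero | here = contradiction refl u≢v
  ... | suc _ | _ = s≤s z≤n

  d-nonadjacent : ∀ {u v} → u ≢ v → ¬ Adj G u v → 2 ≤ d u v
  d-nonadjacent {u} {v} u≢v na with d u v | geodesic u v
  ... | zero | here = contradiction refl u≢v
  ... | suc zero | step a here = contradiction a na
  ... | suc (suc _) | _ = s≤s (s≤s z≤n)

  d-next : ∀ {u v} → u ≢ v → ∃[ w ] (Adj G u w × suc (d w v) ≤ d u v)
  d-next {u} {v} u≢v with d u v | geodesic u v
  ... | _ | here = contradiction refl u≢v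
  ... | _ | step a p = _ , a , s≤s (d-≤ p)

  d-last : ∀ {u v} → u ≢ v → ∃[ w ] (Adj G w v × suc (d u w) ≤ d u v)
  d-last {u} {v} u≢v with d u v | geodesic u v
  ... | _ | here = contradiction refl u≢v
  ... | suc _ | p@(step _ _) = let (w , p' , a) = walk-last G p in w , a , s≤s (d-≤ p')

  -- Composing the moves of a sequence gives a bijection.
  Seq-bijection : ∀ {D T q} → Seq TS G D T q → ∃[ f ] (IsBij D T f × cost d D f ≤ q)
  Seq-bijection {D} (done _) = id , IsBij-id , ≤-reflexive (cost-fixed d {D} {id} λ v _ → d-self v)
  Seq-bijection {D} {q = suc q} (cons {D' = D'} _ (x , y , a , b , c , xy) s)
    with g , bij , le ← Seq-bijection s =
    _ , IsBij-move m bij , +-cancelʳ-≤ (d y (g y)) _ _ (begin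
      cost d D (g [ x ↦ g y ]) + d y (g y) ≡⟨ cost-move d g (g y) m ⟩
      cost d D' g + d x (g y)              ≤⟨ +-mono-≤ le (d-Adj (g y) xy) ⟩
      q + suc (d y (g y))                  ≡⟨ +-suc q _ ⟩
      suc q + d y (g y)                    ∎)
    where
    open ≤-Reasoning
    m : Move D' D y x
    m = Move-sym (a , b , c)

  -- The hypothesis `detour` places `w` on a geodesic from `u` to `f u`. The token on `w` takes over
  -- the rest of that way, while `u` is charged for going to `w` and on to the old target of `w`; by
  -- the triangle inequality the total does not grow.
  IsBij-swap : ∀ {D T f u w} → IsBij D T f → u ∈ D → w ∈ D → d u w + d w (f u) ≤ d u (f u) →
    ∃[ f' ] (IsBij D T f' × cost d D f' ≤ cost d D f × f' w ≡ f u ×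
             (∀ v → v ≢ u → v ≢ w → f' v ≡ f v))
  IsBij-swap {D} {T} {f} {u} {w} bij u∈ w∈ detour with u ≟ w
  ... | yes refl = f , bij , ≤-refl , refl , λ _ _ _ → refl
  ... | no u≢w = f' , IsBij-transpose u∈ w∈ bij , +-cancelʳ-≤ (d u (f u) + d w (f w)) _ _ bound ,
                 cong f (transpose-ʳ u w) , λ v v≢u v≢w → cong f (transpose-≢ u w v≢u v≢w)
    where
    open ≤-Reasoning
    f' = f ∘ transpose u w
    rearrange : ∀ a b c → a + b + c ≡ (a + c) + b
    rearrange = solve-∀
    bound : cost d D f' + (d u (f u) + d w (f w)) ≤ cost d D f + (d u (f u) + d w (f w))
    bound = begin
      cost d D f' + (d u (f u) + d w (f w))           ≡⟨ cost-agree₂ d f f' u∈ w∈ u≢w (λ v v≢u v≢w → cong f (transpose-≢ u w v≢u v≢w)) ⟩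
      cost d D f + (d u (f' u) + d w (f' w))          ≡⟨ cong (cost d D f +_) (cong₂ (λ s t → d u (f s) + d w (f t)) (transpose-ˡ u w) (transpose-ʳ u w)) ⟩
      cost d D f + (d u (f w) + d w (f u))            ≤⟨ +-monoʳ-≤ (cost d D f) (+-monoˡ-≤ (d w (f u)) (d-triangle u w (f w))) ⟩
      cost d D f + (d u w + d w (f w) + d w (f u))    ≡⟨ cong (cost d D f +_) (rearrange (d u w) (d w (f w)) (d w (f u))) ⟩
      cost d D f + (d u w + d w (f u) + d w (f w))    ≤⟨ +-monoʳ-≤ (cost d D f) (+-monoˡ-≤ (d w (f w)) detour) ⟩
      cost d D f + (d u (f u) + d w (f w))            ∎

  FixesCommon : Subset n → Subset n → (Fin n → Fin n) → Set
  FixesCommon D T f = ∀ v → v ∈ D → v ∈ T → f v ≡ v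

  fix-common : ∀ {D T f} → IsBij D T f →
               ∃[ f' ] (IsBij D T f' × cost d D f' ≤ cost d D f × FixesCommon D T f')
  fix-common {D} {T} {f} bij =
    let (f' , bij' , le , fixes) = go (allFin n) in f' , bij' , le , λ v → fixes v (∈-allFin v)
    where
    go : ∀ vs → ∃[ f' ] (IsBij D T f' × cost d D f' ≤ cost d D f ×
                         (∀ v → v ∈ᴸ vs → v ∈ D → v ∈ T → f' v ≡ v))
    go [] = f , bij , ≤-refl , λ _ ()
    go (t ∷ vs) with f₁ , bij₁ , le₁ , fixes ← go vs | t ∈? D | t ∈? T
    ... | no t∉D | _ = f₁ , bij₁ , le₁ , λ { v (here refl) v∈D _ → contradiction v∈D t∉D ; v (there v∈) → fixes v v∈ }
    ... | yes _ | no t∉T = f₁ , bij₁ , le₁ , λ { v (here refl) _ v∈T → contradiction v∈T t∉T ; v (there v∈) → fixes v v∈ }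
    ... | yes t∈D | yes t∈T with u , u∈ , refl ← proj₂ (proj₂ bij₁) t t∈T
      -- The vertex on the geodesic is its endpoint `f₁ u` itself, which carries a token.
      with f₂ , bij₂ , le₂ , f₂t , same ← IsBij-swap {f = f₁} bij₁ u∈ t∈D
             (≤-reflexive (trans (cong (d u (f₁ u) +_) (d-self (f₁ u))) (+-identityʳ _)))
      = f₂ , bij₂ , ≤-trans le₂ le₁ , fixes'
      where
      fixes' : ∀ v → v ∈ᴸ (f₁ u ∷ vs) → v ∈ D → v ∈ T → f₂ v ≡ v
      fixes' v (here refl) _ _ = f₂t
      fixes' v (there v∈) v∈D v∈T with v ≟ f₁ u | v ≟ u
      ... | yes refl | _ = f₂t
      -- The swap undoes nothing: if `u` had been fixed earlier, it would equal its image `f₁ u`,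
      -- the vertex being treated.
      ... | no v≢t | yes refl = contradiction (sym (fixes v v∈ v∈D v∈T)) v≢t
      ... | no v≢t | no v≢u = trans (same v v≢u v≢t) (fixes v v∈ v∈D v∈T)

  -- A slide whose next set has a strictly cheaper matching. Domination is kept apart, since whether
  -- a guard remains is decided case by case.
  record Progress (D T : Subset n) (f : Fin n → Fin n) : Set where
    field
      {source target} : Fin n
      {next}        : Subset n
      {matching}    : Fin n → Fin n
      moves         : Move D next source target
      adjacent      : Adj G source target
      bijective     : IsBij next T matching
      cheaper       : cost d next matching < cost d D f

  open Progress public

  progress-direct : ∀ {D T f u w} → IsBij D T f → u ∈ D → w ∉ D → Adj G u w →
                    suc (d w (f u)) ≤ d u (f u) → Progress D T f
  progress-direct {D} {T} {f} {u} {w} bij u∈ w∉ a closer = record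
    { moves = m ; adjacent = a ; bijective = IsBij-move m bij
    ; cheaper = +-cancelʳ-≤ (d w (f u)) _ _ (begin
        suc (cost d D⁺ f⁺) + d w (f u) ≡⟨ sym (+-suc (cost d D⁺ f⁺) _) ⟩
        cost d D⁺ f⁺ + suc (d w (f u)) ≤⟨ +-monoʳ-≤ (cost d D⁺ f⁺) closer ⟩
        cost d D⁺ f⁺ + d u (f u)       ≡⟨ cost-move d f (f u) m ⟩
        cost d D f + d w (f u)         ∎) }
    where
    open ≤-Reasoning
    D⁺ = move D u w
    f⁺ = f [ w ↦ f u ]
    m : Move D D⁺ u w
    m = move-Move u∈ w∉

all-fixed⇒≡ : IsBij D Dt f → (∀ v → v ∈ D → f v ≡ v) → D ≡ Dt
all-fixed⇒≡ {D = D} {Dt = Dt} (into , _ , onto) fixed = ⊆-antisym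
  (λ {v} v∈ → subst (_∈ Dt) (fixed v v∈) (into v v∈))
  (λ {w} w∈ → let (v , v∈ , e) = onto w w∈ in subst (_∈ D) (trans (sym (fixed v v∈)) e) v∈)

-- This supports the alternative for tokens: either one of them offers a legal slide, or all are
-- settled or blocked.
first-or-all : ∀ {A : Set} {B : Fin n → Set} → (∀ v → A ⊎ B v) → A ⊎ (∀ v → B v)
first-or-all {zero} h = inj₂ λ ()
first-or-all {suc n} h with h zero | first-or-all (h ∘ suc)
... | inj₁ a | _ = inj₁ a
... | inj₂ _ | inj₁ a = inj₁ a
... | inj₂ b | inj₂ bs = inj₂ λ { zero → b ; (suc v) → bs v }

-- Domination in split graphs.

module SplitGraph {G : Graph n} (conn : Connected G) (inK : Fin n → Bool)
  (clique : ∀ u v → inK u ≡ true → inK v ≡ true → ¬ (u ≡ v) → Adj G u v)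
  (independent : ∀ u v → inK u ≡ false → inK v ≡ false → ¬ Adj G u v) where

  InK InS : Fin n → Set
  InK v = inK v ≡ true
  InS v = inK v ≡ false

  side : ∀ v → InK v ⊎ InS v
  side v with inK v
  ... | true = inj₁ refl
  ... | false = inj₂ refl

  K-S-disjoint : ∀ {v} → InK v → ¬ InS v
  K-S-disjoint k s with () ← trans (sym k) s

  neighbour-InK : ∀ {u w} → Adj G u w → InS u → InK w
  neighbour-InK {u} {w} a u∈S with side w
  ... | inj₁ w∈K = w∈K
  ... | inj₂ w∈S = contradiction a (independent u w u∈S w∈S)

  neighbour : ∀ {u v} → u ≢ v → ∃[ w ] Adj G u w
  neighbour {u} {v} u≢v with conn u v
  ... | _ , here = contradiction refl u≢v
  ... | _ , step a _ = _ , a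

  clique-walk : ∀ {u v} → InK u → InK v → ∃[ ℓ ] (ℓ ≤ 1 × Walk G u v ℓ)
  clique-walk {u} {v} u∈K v∈K with u ≟ v
  ... | yes refl = 0 , z≤n , here
  ... | no u≢v = 1 , ≤-refl , step (clique u v u∈K v∈K u≢v) here

  -- A vertex of the independent set has a neighbour by connectedness; that neighbour is in the
  -- clique, hence within distance 1 of `b`.
  guarded⇒IsD2DS : ∀ {D b} → b ∈ D → InK b → IsD2DS G D
  guarded⇒IsD2DS {D} {b} b∈ b∈K v with side v
  ... | inj₁ v∈K with ℓ , ℓ≤1 , p ← clique-walk b∈K v∈K = b , b∈ , ℓ , m≤n⇒m≤1+n ℓ≤1 , p
  ... | inj₂ v∈S with w , vw ← neighbour {v} {b} (λ { refl → K-S-disjoint b∈K v∈S })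
    with ℓ , ℓ≤1 , p ← clique-walk b∈K (neighbour-InK vw v∈S) =
    b , b∈ , ℓ + 1 , +-monoˡ-≤ 1 ℓ≤1 , walk-++ G p (step (Adj-sym G vw) here)

  -- With `b` as the only clique vertex, every other vertex is adjacent to `b`. The graph is a star,
  -- of diameter at most 2.
  star⇒IsD2DS : ∀ {D b u} → InK b → (∀ c → InK c → c ≡ b) → u ∈ D → IsD2DS G D
  star⇒IsD2DS {D} {b} {u} b∈K only u∈ v with side u
  ... | inj₁ u∈K = guarded⇒IsD2DS u∈ u∈K v
  ... | inj₂ u∈S with w , uw ← neighbour {u} {b} (λ { refl → K-S-disjoint b∈K u∈S })
    with refl ← only w (neighbour-InK uw u∈S) with side v
  ... | inj₁ v∈K with refl ← only v v∈K = u , u∈ , 1 , s≤s z≤n , step uw here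
  ... | inj₂ v∈S with w , vw ← neighbour {v} {b} (λ { refl → K-S-disjoint b∈K v∈S })
    with refl ← only w (neighbour-InK vw v∈S) =
    u , u∈ , 2 , ≤-refl , step uw (step (Adj-sym G vw) here)

  -- Token jumping.

  -- Exchanges move only tokens off `T`, so the common vertex `b` guards every intermediate set.
  guarded-exchange : ∀ {b D T r} → InK b → b ∈ T → b ∈ D → Exchange T D r → Seq TJ G D T r
  guarded-exchange b∈K b∈T b∈D nil = done (guarded⇒IsD2DS b∈D b∈K)
  guarded-exchange b∈K b∈T b∈D (swap m x∉ y∈ e) =
    cons (guarded⇒IsD2DS b∈D b∈K) (Step⁺ {R = TJ} {G = G} m tt)
      (guarded-exchange b∈K b∈T (Move-stay m b∈D (∈∉⇒≢ b∈T x∉)) e)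

  jump-to-guarded : ∀ {b D T} → InK b → b ∈ T → IsD2DS G D → ∣ D ∣ ≡ ∣ T ∣ →
                    ∃[ r ] (Exchange T D r × Seq TJ G D T r)
  jump-to-guarded {b} {D} {T} b∈K b∈T ds card with b ∈? D
  ... | yes b∈D with r , e ← Exchange-exists D T card = r , e , guarded-exchange b∈K b∈T b∈D e
  ... | no b∉D with equal-or-exchange D T card
  ... | inj₁ refl = contradiction b∈T b∉D
  ... | inj₂ ((x , x∈ , x∉) , _) with m ← move-Move x∈ b∉D
    with r , e ← Exchange-exists (move D x b) T (trans (∣∣-Move m) card) =
    suc r , swap m x∉ b∈T e , cons ds (Step⁺ {R = TJ} {G = G} m tt)
      (guarded-exchange b∈K b∈T (proj₁ (proj₁ (proj₂ m))) e)

  jump : ∀ {D T} → IsD2DS G D → IsD2DS G T → ∣ D ∣ ≡ ∣ T ∣ →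
         ∃[ q ] (q ≤ MStarTJ D T + 1 × Seq TJ G D T q)
  jump {D} {T} dsD dsT card with any? (λ b → b ∈? T ×-dec inK b ≟ᵇ true)
  ... | yes (b , b∈T , b∈K) with r , e , s ← jump-to-guarded b∈K b∈T dsD card =
    r , ≤-trans (≤-reflexive (sym (MStarTJ-Exchange e))) (m≤m+n _ 1) , s
  ... | no T⊆S with equal-or-exchange D T card
  ... | inj₁ refl = 0 , z≤n , done dsD
  ... | inj₂ ((x , x∈ , x∉) , (t , t∈ , t∉)) with b , tb ← neighbour {t} {x} (∈∉⇒≢ t∈ x∉) =
    finish (side t) (side b)
    where
    finish : InK t ⊎ InS t → InK b ⊎ InS b → _
    finish (inj₁ t∈K) _ = contradiction (t , t∈ , t∈K) T⊆S
    finish (inj₂ t∈S) (inj₂ b∈S) = contradiction tb (independent t b t∈S b∈S)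
    finish (inj₂ t∈S) (inj₁ b∈K)
      -- All targets lie in the independent set, so the missing target `t` is traded for its clique
      -- neighbour `b`; the one extra jump at the end goes from `b` to `t`.
      with m ← move-Move t∈ (λ b∈T → T⊆S (b , b∈T , b∈K))
      with r , e , s ← jump-to-guarded {T = move T t b} b∈K (proj₁ (proj₁ (proj₂ m))) dsD
                         (trans card (sym (∣∣-Move m)))
      = suc r , ≤-trans (≤-reflexive (+-comm 1 r)) (+-monoˡ-≤ 1 bound) ,
        snoc s (Step⁺ {R = TJ} {G = G} (Move-sym m) tt) dsT
      where
      -- Dropping `t`, which is not in `D`, saves 1, and adding `b` costs at most 1.
      closer : symdiff (move T t b) D ≤ symdiff T D
      closer with e ← symdiff-Move {T = D} m rewrite ∉⇒lookup t∉ =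
        +-cancelʳ-≤ 1 _ _ (≤-trans (+-monoʳ-≤ _ (m≤m+n 1 (bit (lookup D b))))
          (≤-trans (≤-reflexive e) (+-monoʳ-≤ (symdiff T D) (bit≤1 (not (lookup D b))))))
      bound : r ≤ MStarTJ D T
      bound = ≤-trans (≤-reflexive (sym (MStarTJ-Exchange e)))
        (/-monoˡ-≤ 2 (subst₂ _≤_ (symdiff-comm (move T t b) D) (symdiff-comm T D) closer))

  -- Token sliding.

  module Sliding {d : Fin n → Fin n → ℕ} (isd : IsDistFn G d) where
    open Distance isd

    -- If `w` were an inner vertex of the geodesic in the independent set, its two neighbours there
    -- would be clique vertices at distance at most 1, a shortcut past `w`.
    next-InK : ∀ {u w t} → Adj G u w → suc (d w t) ≤ d u t → InK w ⊎ w ≡ t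
    next-InK {u} {w} {t} uw closer with side w | w ≟ t
    ... | inj₁ w∈K | _ = inj₁ w∈K
    ... | inj₂ _ | yes e = inj₂ e
    ... | inj₂ w∈S | no w≢t with z , wz , closer' ← d-next w≢t
      with ℓ , ℓ≤1 , p ← clique-walk (neighbour-InK (Adj-sym G uw) w∈S) (neighbour-InK wz w∈S) =
      contradiction (≤-trans closer (≤-trans (d-triangle u z t)
        (≤-trans (+-monoˡ-≤ (d z t) (≤-trans (d-≤ p) ℓ≤1)) closer'))) (<-irrefl refl)

    -- The last token on a geodesic from u to the free vertex f u can take over the rest of the way.
    advance : ∀ {D T t} k u f → IsBij D T f → u ∈ D → f u ≡ t → t ∉ D → d u t ≤ k →
              Σ (Progress D T f) λ p → InK (target p) ⊎ target p ≡ t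
    advance {D} {T} k u f bij u∈ refl t∉ le with w , uw , closer ← d-next (∈∉⇒≢ u∈ t∉) with w ∈? D
    ... | no w∉ = progress-direct bij u∈ w∉ uw closer , next-InK uw closer
    -- The occupied `w` inherits the target. It is strictly closer to it, so the bound `k`
    -- decreases.
    ... | yes w∈ with f' , bij' , le' , f'w , _ ← IsBij-swap {f = f} bij u∈ w∈
                        (≤-trans (+-monoˡ-≤ (d w (f u)) (d-≤ (step uw here))) closer)
        with k | ≤-trans closer le
    ... | suc k' | s≤s le'' with p , near ← advance k' w f' bij' w∈ f'w t∉ le'' =
      record { moves = moves p ; adjacent = adjacent p ; bijective = bijective p
             ; cheaper = <-≤-trans (cheaper p) le' } , near

    Reach : Subset n → Subset n → ℕ → Set
    Reach D T k = ∃[ q ] (q ≤ k × Seq TS G D T q)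

    module ToGuarded {T : Subset n} {b : Fin n} (b∈K : InK b) (b∈T : b ∈ T) where

      dsT : IsD2DS G T
      dsT = guarded⇒IsD2DS b∈T b∈K

      Blocked : (Fin n → Fin n) → Fin n → Set
      Blocked f v = InS v × InS (f v) × Adj G v b × Adj G b (f v)

      Legal : Subset n → (Fin n → Fin n) → Set
      Legal D f = Σ (Progress D T f) λ p → IsD2DS G (next p)

      -- The two slides over `b` are paid for by the matching: distinct vertices of the independent
      -- set are at distance at least 2, and this distance drops out of the cost once the token is
      -- settled.
      leap : ∀ {D f v} → IsBij D T f → v ∈ D → b ∉ D → f v ∉ D → Blocked f v →
             ∃[ D₂ ] ∃[ D₃ ] ∃[ f' ]
               (Move D D₂ v b × Move D₂ D₃ b (f v) × IsBij D₃ T f' × 2 + cost d D₃ f' ≤ cost d D f ×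
                f' (f v) ≡ f v × (∀ w → w ≢ b → w ≢ f v → f' w ≡ f w))
      leap {D} {f} {v} bij v∈ b∉ t∉ (v∈S , t∈S , vb , bt) =
        D₂ , D₃ , f₃ , m₁ , m₂ , IsBij-move m₂ (IsBij-move m₁ bij) , cheaper₃ ,
        trans (↦-here f₂ t (f₂ b)) f₂b ,
        λ w w≢b w≢t → trans (↦-there f₂ (f₂ b) w≢t) (↦-there f t w≢b)
        where
        t = f v
        t≢b : t ≢ b
        t≢b refl = K-S-disjoint b∈K t∈S
        D₂ = move D v b
        D₃ = move D₂ b t
        m₁ : Move D D₂ v b
        m₁ = move-Move v∈ b∉
        m₂ : Move D₂ D₃ b t
        m₂ = move-Move (proj₁ (proj₁ (proj₂ m₁))) λ t∈ → t∉ (Move-stay (Move-sym m₁) t∈ t≢b)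
        f₂ = f [ b ↦ t ]
        f₃ = f₂ [ t ↦ f₂ b ]
        f₂b : f₂ b ≡ t
        f₂b = ↦-here f b t
        cheaper₃ : 2 + cost d D₃ f₃ ≤ cost d D f
        cheaper₃ = +-cancelʳ-≤ (d b t) _ _ (begin
          2 + cost d D₃ f₃ + d b t           ≤⟨ +-monoˡ-≤ (d b t) (+-monoˡ-≤ (cost d D₃ f₃)
                                                  (d-nonadjacent (∈∉⇒≢ v∈ t∉) (independent v t v∈S t∈S))) ⟩
          d v t + cost d D₃ f₃ + d b t       ≡⟨ +-assoc (d v t) _ _ ⟩
          d v t + (cost d D₃ f₃ + d b t)     ≡⟨ cong (λ s → d v t + (cost d D₃ f₃ + d b s)) (sym f₂b) ⟩
          d v t + (cost d D₃ f₃ + d b (f₂ b)) ≡⟨ cong (d v t +_) (cost-move d f₂ (f₂ b) m₂) ⟩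
          d v t + (cost d D₂ f₂ + d t (f₂ b)) ≡⟨ cong (λ s → d v t + (cost d D₂ f₂ + d t s)) f₂b ⟩
          d v t + (cost d D₂ f₂ + d t t)     ≡⟨ cong (λ s → d v t + (cost d D₂ f₂ + s)) (d-self t) ⟩
          d v t + (cost d D₂ f₂ + 0)         ≡⟨ cong (d v t +_) (+-identityʳ _) ⟩
          d v t + cost d D₂ f₂               ≡⟨ +-comm (d v t) _ ⟩
          cost d D₂ f₂ + d v t               ≡⟨ cost-move d f t m₁ ⟩
          cost d D f + d b t                 ∎)
          where open ≤-Reasoning

      module _ {c : Fin n} (c∈K : InK c) (c≢b : c ≢ b) where

        private
          bc : Adj G b c
          bc = clique b c b∈K c∈K (c≢b ∘ sym)

        -- The guard waits on `c`. The clause `v ∉ T` ensures that no blocked token occupies the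
        -- target of another, as `target-free` requires.
        Parked : Subset n → (Fin n → Fin n) → Set
        Parked D f = ∀ v → v ∈ D → v ≢ c → f v ≡ v ⊎ (v ∉ T × Blocked f v)

        target-free : ∀ {D f} → IsBij D T f → c ∉ T → Parked D f → ∀ v → v ∈ D → f v ≢ v → f v ∉ D
        target-free {f = f} (into , inj , _) c∉T tokens v v∈ moved t∈ with f v ≟ c
        ... | yes t≡c = c∉T (subst (_∈ T) t≡c (into v v∈))
        ... | no t≢c with tokens (f v) t∈ t≢c
        ... | inj₁ fixed = moved (inj (f v) v t∈ v∈ fixed)
        ... | inj₂ (t∉T , _) = t∉T (into v v∈)

        -- While the guard c keeps b free, each blocked token slides over b to its target.
        unblock : ∀ k D f → IsBij D T f → c ∈ D → b ∉ D → c ∉ T → f c ≡ b →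
                  Parked D f → cost d D f ≤ k → Reach D T k
        unblock k D f bij@(into , inj , onto) c∈ b∉ c∉T fc tokens le
          with any? (λ v → v ∈? D ×-dec ¬? (v ≟ c) ×-dec ¬? (f v ≟ v))
        -- All other tokens are settled, so the return of the guard from `c` to `b` completes `T`.
        -- Its distance to `b` is still part of the cost, which leaves room in `k` for this slide.
        ... | no none with m ← move-Move c∈ b∉ =
          1 , ≤-trans 1≤cost le ,
          cons (guarded⇒IsD2DS c∈ c∈K) (Step⁺ {R = TS} {G = G} m (Adj-sym G bc))
            (subst (λ D' → Seq TS G D' T 0) (sym (all-fixed⇒≡ (IsBij-move m bij) fixed)) (done dsT))
          where
          fixed : ∀ v → v ∈ move D c b → (f [ b ↦ f c ]) v ≡ v
          fixed v v∈ with v ≟ b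
          ... | yes refl = trans (↦-here f b (f c)) fc
          ... | no v≢b = trans (↦-there f (f c) v≢b) (decidable-stable (f v ≟ v)
            λ moved → none (v , Move-stay (Move-sym m) v∈ v≢b , ∈∉⇒≢ v∈ (proj₂ (proj₁ m)) , moved))
          1≤cost : 1 ≤ cost d D f
          1≤cost with e ← cost-move d f (f c) m rewrite fc | d-self b | +-identityʳ (cost d D f) =
            ≤-trans (d-pos c≢b) (≤-trans (m≤n+m (d c b) _) (≤-reflexive e))
        ... | yes (v , v∈ , v≢c , moved) with tokens v v∈ v≢c
        ... | inj₁ fixed = contradiction fixed moved
        ... | inj₂ (v∉T , blocked)
          with D₂ , D₃ , f' , m₁ , m₂ , bij' , drop , settled , same ← leap {f = f} bij v∈ b∉ (target-free bij c∉T tokens v v∈ moved) blocked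
          with k | ≤-trans drop le
        -- The cost drops by 2 for the two slides made, so `k` bounds the remaining cost and the
        -- remaining length alike.
        ... | suc (suc k') | s≤s (s≤s le') =
          let (q , q≤ , s) = unblock k' D₃ f' bij'
                (Move-stay m₂ (Move-stay m₁ c∈ (v≢c ∘ sym)) c≢b) (proj₂ (proj₁ m₂)) c∉T
                (trans (same c c≢b c≢t) fc) tokens' le'
          in
          suc (suc q) , s≤s (s≤s q≤) ,
          cons (guarded⇒IsD2DS c∈ c∈K) (Step⁺ {R = TS} {G = G} m₁ (proj₁ (proj₂ (proj₂ blocked))))
            (cons (guarded⇒IsD2DS (Move-stay m₁ c∈ (v≢c ∘ sym)) c∈K)
              (Step⁺ {R = TS} {G = G} m₂ (proj₂ (proj₂ (proj₂ blocked)))) s)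
          where
          c≢t : c ≢ f v
          c≢t c≡t = c∉T (subst (_∈ T) (sym c≡t) (into v v∈))
          tokens' : Parked D₃ f'
          tokens' w w∈ w≢c with w ≟ f v
          ... | yes refl = inj₁ settled
          ... | no w≢t with w≢b ← ∈∉⇒≢ w∈ (proj₂ (proj₁ m₂))
            with tokens w (Move-stay (Move-sym m₁) (Move-stay (Move-sym m₂) w∈ w≢t) w≢b) w≢c
          ... | e rewrite same w w≢b w≢t = e

        -- The slide from `b` to `c` is one extra step and raises the cost by at most 1, the
        -- distance back to `b`. Together these are the additive 2.
        pay : ∀ D f → IsBij D T f → FixesCommon D T f → b ∈ D → c ∉ D → c ∉ T →
              (∀ v → v ∈ D → f v ≡ v ⊎ Blocked f v) → Reach D T (cost d D f + 2)
        pay D f bij fixes b∈ c∉ c∉T tokens =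
          let (q , q≤ , s) = unblock (cost d D f + 1) (move D b c) (f [ c ↦ f b ]) (IsBij-move m bij)
                (proj₁ (proj₁ (proj₂ m))) (proj₂ (proj₁ m)) c∉T
                (trans (↦-here f c (f b)) fb) tokens' bound
          in
          suc q , subst (suc q ≤_) (sym (+-suc (cost d D f) 1)) (s≤s q≤) ,
          cons (guarded⇒IsD2DS b∈ b∈K) (Step⁺ {R = TS} {G = G} m bc) s
          where
          m : Move D (move D b c) b c
          m = move-Move b∈ c∉
          fb : f b ≡ b
          fb = fixes b b∈ b∈T
          bound : cost d (move D b c) (f [ c ↦ f b ]) ≤ cost d D f + 1
          bound = ≤-trans (m≤m+n _ _) (≤-trans (≤-reflexive (cost-move d f (f b) m))
            (+-monoʳ-≤ (cost d D f) (subst (λ t → d c t ≤ 1) (sym fb) (d-≤ (step (Adj-sym G bc) here)))))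
          tokens' : Parked (move D b c) (f [ c ↦ f b ])
          tokens' v v∈ v≢c with v∈D ← Move-stay (Move-sym m) v∈ v≢c
            with v ∈? T | tokens v v∈D
          ... | yes v∈T | _ = inj₁ (trans (↦-there f (f b) v≢c) (fixes v v∈D v∈T))
          ... | no _ | inj₁ e = inj₁ (trans (↦-there f (f b) v≢c) e)
          ... | no v∉T | inj₂ bl rewrite ↦-there f {x = c} (f b) v≢c = inj₂ (v∉T , bl)

        -- The slide offered by `advance` is legal if it lands on the clique or if another clique
        -- token stays behind. It can fail only when it takes the guard from `b` to a target in the
        -- independent set.
        legal-or-blocked : ∀ {D f} → IsBij D T f → FixesCommon D T f → b ∈ D → ∀ v → v ∈ D →
                           Legal D f ⊎ (f v ≡ v ⊎ (c ∉ D × Blocked f v))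
        legal-or-blocked {D} {f} bij@(into , inj , onto) fixes b∈ v v∈ with f v ≟ v
        ... | yes fixed = inj₂ (inj₁ fixed)
        ... | no moved = let (p , near) = advance (d v (f v)) v f bij v∈ refl t∉ ≤-refl in analyse p near
          where
          t∉ : f v ∉ D
          t∉ t∈ = moved (inj (f v) v t∈ v∈ (fixes (f v) t∈ (into v v∈)))
          by-guard : ∀ {g} (p : Progress D T f) → InK g → g ∈ next p → Legal D f ⊎ _
          by-guard p g∈K g∈ = inj₁ (p , guarded⇒IsD2DS g∈ g∈K)
          analyse : (p : Progress D T f) → InK (target p) ⊎ target p ≡ f v →
                    Legal D f ⊎ (f v ≡ v ⊎ (c ∉ D × Blocked f v))
          analyse p (inj₁ y∈K) = by-guard p y∈K (proj₁ (proj₁ (proj₂ (moves p))))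
          analyse p (inj₂ y≡t) with source p ≟ b | side v | side (f v) | c ∈? D
          ... | no x≢b | _ | _ | _ = by-guard p b∈K (Move-stay (moves p) b∈ (x≢b ∘ sym))
          -- The token on `b` is settled and `v` is not, so `v` is a second clique token and guards.
          ... | yes x≡b | inj₁ v∈K | _ | _ = by-guard p v∈K (Move-stay (moves p) v∈ λ v≡x →
                moved (subst (λ w → f w ≡ w) (sym (trans v≡x x≡b)) (fixes b b∈ b∈T)))
          ... | yes x≡b | inj₂ _ | inj₁ t∈K | _ =
                by-guard p (subst InK (sym y≡t) t∈K) (proj₁ (proj₁ (proj₂ (moves p))))
          ... | yes x≡b | inj₂ _ | inj₂ _ | yes c∈ =
                by-guard p c∈K (Move-stay (moves p) c∈ λ c≡x → c≢b (trans c≡x x≡b))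
          -- The first vertex `w` of a geodesic from `v` is in the clique. If it is free, `v` slides
          -- there instead; if it carries a token other than that on `b`, that token guards; if it
          -- is `b`, then `v` is blocked.
          ... | yes x≡b | inj₂ v∈S | inj₂ t∈S | no c∉
            with w , vw , closer ← d-next {v} {f v} (moved ∘ sym) with w ∈? D | w ≟ b
          ... | no w∉ | _ = inj₁ (p′ , guarded⇒IsD2DS (proj₁ (proj₁ (proj₂ (moves p′)))) (neighbour-InK vw v∈S))
            where p′ = progress-direct {f = f} bij v∈ w∉ vw closer
          ... | yes w∈ | no w≢b = by-guard p (neighbour-InK vw v∈S)
                (Move-stay (moves p) w∈ λ w≡x → w≢b (trans w≡x x≡b))
          ... | yes _ | yes refl = inj₂ (inj₂ (c∉ , v∈S , t∈S , vw , subst₂ (Adj G) x≡b y≡t (adjacent p)))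

      legal-or-reach : (∃[ c ] (InK c × c ≢ b)) ⊎ (∀ c → InK c → c ≡ b) → ∀ {D f} →
                       IsBij D T f → FixesCommon D T f → Legal D f ⊎ Reach D T (cost d D f + 2)
      legal-or-reach others {D} {f} bij@(into , inj , onto) fixes with b ∈? D
      -- The token destined for `b` is advanced first: the slide ends on the clique in any case, as
      -- its final target `b` is a clique vertex.
      ... | no b∉ with u , u∈ , e ← onto b b∈T
        with p , near ← advance (d u b) u f bij u∈ e b∉ ≤-refl =
        inj₁ (p , guarded⇒IsD2DS (proj₁ (proj₁ (proj₂ (moves p)))) (y∈K near))
        where
        y∈K : InK (target p) ⊎ target p ≡ b → InK (target p)
        y∈K (inj₁ k) = k
        y∈K (inj₂ refl) = b∈K
      ... | yes b∈ with any? (λ v → v ∈? D ×-dec ¬? (f v ≟ v)) | others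
      ... | no none | _ = inj₂ (0 , z≤n , subst (λ D → Seq TS G D T 0) (sym D≡T) (done dsT))
        where
        D≡T : D ≡ T
        D≡T = all-fixed⇒≡ bij λ v v∈ → decidable-stable (f v ≟ v) λ moved → none (v , v∈ , moved)
      -- In a star every nonempty set dominates, so any slide that makes progress is legal.
      ... | yes (v , v∈ , moved) | inj₂ only
        with p , _ ← advance (d v (f v)) v f bij v∈ refl
                       (λ t∈ → moved (inj (f v) v t∈ v∈ (fixes (f v) t∈ (into v v∈)))) ≤-refl =
        inj₁ (p , star⇒IsD2DS b∈K only (proj₁ (proj₁ (proj₂ (moves p)))))
      ... | yes (v₀ , v₀∈ , moved) | inj₁ (c , c∈K , c≢b)
        with first-or-all attempt
        where
        attempt : ∀ v → Legal D f ⊎ (v ∈ D → f v ≡ v ⊎ (c ∉ D × Blocked f v))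
        attempt v with v ∈? D
        ... | no v∉ = inj₂ λ v∈ → contradiction v∈ v∉
        ... | yes v∈ with legal-or-blocked c∈K c≢b bij fixes b∈ v v∈
        ... | inj₁ legal = inj₁ legal
        ... | inj₂ r = inj₂ λ _ → r
      ... | inj₁ legal = inj₁ legal
      ... | inj₂ tokens with tokens v₀ v₀∈
      ... | inj₁ fixed = contradiction fixed moved
      ... | inj₂ (c∉ , _) = inj₂ (pay c∈K c≢b D f bij fixes b∈ c∉ c∉T λ v v∈ → drop-c (tokens v v∈))
        where
        drop-c : ∀ {v} → f v ≡ v ⊎ (c ∉ D × Blocked f v) → f v ≡ v ⊎ Blocked f v
        drop-c (inj₁ e) = inj₁ e
        drop-c (inj₂ (_ , bl)) = inj₂ bl
        -- A token heading for `c` would be settled, although `c` is free, or blocked, although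
        -- blocked tokens have targets in the independent set.
        c∉T : c ∉ T
        c∉T c∈T with u , u∈ , e ← onto c c∈T with tokens u u∈
        ... | inj₁ fixed = c∉ (subst (_∈ D) (trans (sym fixed) e) u∈)
        ... | inj₂ (_ , _ , t∈S , _) = K-S-disjoint c∈K (subst InS e t∈S)

      -- Each legal slide lowers the cost, on which the induction runs. Common tokens are fixed anew
      -- in every round, because the matching that comes with a slide need not fix them.
      slide : ∀ k D f → IsD2DS G D → IsBij D T f → cost d D f ≤ k → Reach D T (k + 2)
      slide k D f ds bij le with f' , bij' , le' , fixes ← fix-common {f = f} bij
        with legal-or-reach others bij' fixes
        where
        others : (∃[ c ] (InK c × c ≢ b)) ⊎ (∀ c → InK c → c ≡ b)
        others with any? (λ c → inK c ≟ᵇ true ×-dec ¬? (c ≟ b))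
        ... | yes p = inj₁ p
        ... | no none = inj₂ λ c c∈K → decidable-stable (c ≟ b) λ c≢b → none (c , c∈K , c≢b)
      ... | inj₂ (q , q≤ , s) = q , ≤-trans q≤ (+-monoˡ-≤ 2 (≤-trans le' le)) , s
      ... | inj₁ (p , ds') with k | ≤-trans (cheaper p) (≤-trans le' le)
      ... | suc k' | s≤s le'' with q , q≤ , s ← slide k' _ _ ds' (bijective p) le'' =
        suc q , s≤s q≤ , cons ds (Step⁺ {R = TS} {G = G} (moves p) (adjacent p)) s

    slide-any : ∀ {D T f} → IsD2DS G D → IsD2DS G T → IsBij D T f → Reach D T (cost d D f + 2)
    slide-any {D} {T} {f} dsD dsT bij with any? (λ b → b ∈? T ×-dec inK b ≟ᵇ true)
    ... | yes (b , b∈T , b∈K) = ToGuarded.slide b∈K b∈T _ D f dsD bij ≤-refl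
    ... | no T⊆S with any? (λ v → v ∈? D ×-dec ¬? (f v ≟ v))
    ... | no none = 0 , z≤n , subst (λ D → Seq TS G D T 0)
          (sym (all-fixed⇒≡ bij λ v v∈ → decidable-stable (f v ≟ v) λ moved → none (v , v∈ , moved))) (done dsT)
    ... | yes (v , v∈ , moved) with w , wt , closer ← d-last {v} {f v} (moved ∘ sym) =
      finish (side (f v)) (side w)
      where
      t∈ : f v ∈ T
      t∈ = proj₁ bij v v∈
      finish : InK (f v) ⊎ InS (f v) → InK w ⊎ InS w → Reach D T (cost d D f + 2)
      finish (inj₁ t∈K) _ = contradiction (f v , t∈ , t∈K) T⊆S
      finish (inj₂ t∈S) (inj₂ w∈S) = contradiction wt (independent w (f v) w∈S t∈S)
      -- Target `f v` is traded for the vertex `w` before it on a geodesic from `v`. The matching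
      -- becomes cheaper by at least 1, which pays for the final slide from `w` to `f v`.
      finish (inj₂ t∈S) (inj₁ w∈K) with m ← move-Move t∈ (λ w∈T → T⊆S (w , w∈T , w∈K))
        with q , q≤ , s ← ToGuarded.slide {T = move T (f v) w} w∈K (proj₁ (proj₁ (proj₂ m))) _ D (f [ v ↦ w ])
                             dsD (IsBij-retarget {f = f} m bij v∈ refl) ≤-refl =
        suc q , ≤-trans (s≤s q≤) (+-monoˡ-≤ 2 cheaper') ,
        snoc s (Step⁺ {R = TS} {G = G} (Move-sym m) wt) dsT
        where
        cheaper' : suc (cost d D (f [ v ↦ w ])) ≤ cost d D f
        cheaper' = +-cancelʳ-≤ (d v w) _ _ (begin
          suc (cost d D f⁺) + d v w ≡⟨ sym (+-suc (cost d D f⁺) _) ⟩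
          cost d D f⁺ + suc (d v w) ≤⟨ +-monoʳ-≤ (cost d D f⁺) closer ⟩
          cost d D f⁺ + d v (f v)   ≡⟨ cost-update d f w v∈ ⟩
          cost d D f + d v w        ∎)
          where
          open ≤-Reasoning
          f⁺ = f [ v ↦ w ]

-- Sharpness.

-- A function that vanishes at `v` and drops by at most 1 along each edge bounds the length of walks
-- to `v` from below. For a concrete graph this reduces minimality to a finite check.
IsDistFn-potential : {G : Graph n} {d : Fin n → Fin n → ℕ} → (∀ u v → Walk G u v (d u v)) →
  (∀ v → d v v ≡ 0) → (∀ u w v → Adj G u w → d u v ≤ suc (d w v)) → IsDistFn G d
IsDistFn-potential {G = G} {d = d} walks self lipschitz u v = walks u v , λ _ → lower
  where
  lower : ∀ {u ℓ} → Walk G u v ℓ → d u v ≤ ℓ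
  lower here = ≤-reflexive (self v)
  lower (step a p) = ≤-trans (lipschitz _ _ v a) (s≤s (lower p))

matrixGraph : (A : Vec (Subset n) n) →
  (∀ v → lookup (lookup A v) v ≡ false) →
  (∀ u v → lookup (lookup A u) v ≡ lookup (lookup A v) u) → Graph n
matrixGraph A irr s = record { adj = λ u v → lookup (lookup A u) v ; irrefl = irr ; sym = s }

-- Two leaves (2, 3) at the clique vertex 0 and one leaf (4) at the clique vertex 1. The token on 0 is in the way of the
-- token that has to go from 2 to 3, and it may not leave the clique unless another token is there.
module SlidingExample where

  A : Vec (Subset 5) 5
  A = (false ∷ true  ∷ true  ∷ true  ∷ false ∷ [])
    ∷ (true  ∷ false ∷ false ∷ false ∷ true  ∷ [])
    ∷ (true  ∷ false ∷ false ∷ false ∷ false ∷ [])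
    ∷ (true  ∷ false ∷ false ∷ false ∷ false ∷ [])
    ∷ (false ∷ true  ∷ false ∷ false ∷ false ∷ []) ∷ []

  G₅ : Graph 5
  G₅ = matrixGraph A (from-yes (all? λ v → lookup (lookup A v) v ≟ᵇ false))
    (from-yes (all? λ u → all? λ v → lookup (lookup A u) v ≟ᵇ lookup (lookup A v) u))

  distances : Vec (Vec ℕ 5) 5
  distances = (0 ∷ 1 ∷ 1 ∷ 1 ∷ 2 ∷ [])
            ∷ (1 ∷ 0 ∷ 2 ∷ 2 ∷ 1 ∷ [])
            ∷ (1 ∷ 2 ∷ 0 ∷ 2 ∷ 3 ∷ [])
            ∷ (1 ∷ 2 ∷ 2 ∷ 0 ∷ 3 ∷ [])
            ∷ (2 ∷ 1 ∷ 3 ∷ 3 ∷ 0 ∷ []) ∷ []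

  d₅ : Fin 5 → Fin 5 → ℕ
  d₅ u v = lookup (lookup distances u) v

  walks : ∀ u v → Walk G₅ u v (d₅ u v)
  walks = from-yes (all? λ u → all? λ v → Walk? G₅ u v (d₅ u v))

  isDist : IsDistFn G₅ d₅
  isDist = IsDistFn-potential walks (from-yes (all? λ v → d₅ v v ≟ⁿ 0))
    (from-yes (all? λ u → all? λ w → all? λ v → T? (adj G₅ u w) →-dec d₅ u v ≤? suc (d₅ w v)))

  split : IsSplit G₅
  split = inK₅ ,
    from-yes (all? λ u → all? λ v → inK₅ u ≟ᵇ true →-dec (inK₅ v ≟ᵇ true →-dec (¬? (u ≟ v) →-dec T? (adj G₅ u v)))) ,
    from-yes (all? λ u → all? λ v → inK₅ u ≟ᵇ false →-dec (inK₅ v ≟ᵇ false →-dec ¬? (T? (adj G₅ u v))))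
    where
    inK₅ : Fin 5 → Bool
    inK₅ = lookup (true ∷ true ∷ false ∷ false ∷ false ∷ [])

  Ds₅ Dt₅ : Subset 5
  Ds₅ = true ∷ false ∷ true  ∷ false ∷ false ∷ []
  Dt₅ = true ∷ false ∷ false ∷ true  ∷ false ∷ []

  isMStar : IsMStarTS d₅ Ds₅ Dt₅ 2
  isMStar = (match , from-yes (IsBij? Ds₅ Dt₅ match) , refl) , λ f (into , inj , _) →
    lower (f zero) (f (suc (suc zero))) (into _ here) (into _ (there (there here)))
      (λ e → contradiction (inj _ _ here (there (there here)) e) λ ())
    where
    match : Fin 5 → Fin 5
    match = id [ suc (suc zero) ↦ suc (suc (suc zero)) ]
    -- The cost evaluates to the terms of the tokens on 0 and 2, with a trailing 0 from the empty
    -- rest of the sum; both ways to assign the two targets cost 2.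
    lower : ∀ u v → u ∈ Dt₅ → v ∈ Dt₅ → u ≢ v → 2 ≤ d₅ zero u + (d₅ (suc (suc zero)) v + 0)
    lower = from-yes (all? λ u → all? λ v → u ∈? Dt₅ →-dec (v ∈? Dt₅ →-dec
      (¬? (u ≟ v) →-dec 2 ≤? d₅ zero u + (d₅ (suc (suc zero)) v + 0))))

  isOpt : IsOpt TS G₅ Ds₅ Dt₅ 4
  isOpt = from-yes (Seq? TS G₅ Ds₅ Dt₅ 4) , λ
    { 0 s → contradiction s (from-no (Seq? TS G₅ Ds₅ Dt₅ 0))
    ; 1 s → contradiction s (from-no (Seq? TS G₅ Ds₅ Dt₅ 1))
    ; 2 s → contradiction s (from-no (Seq? TS G₅ Ds₅ Dt₅ 2))
    ; 3 s → contradiction s (from-no (Seq? TS G₅ Ds₅ Dt₅ 3))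
    ; (suc (suc (suc (suc q)))) _ → s≤s (s≤s (s≤s (s≤s z≤n))) }

-- The clique vertices 0, 1, 2, 3 stand for the pairs (i , j) with i, j ∈ {0, 1} in lexicographic order. The sources 4, 5 are
-- joined to the pairs with first entry 0, 1, the targets 6, 7 to those with second entry 0, 1, and 8, …, 11 are leaves
-- at the four pairs. A set of one source and one target misses the leaf at the pair it does not meet.
module JumpingExample where

  A : Vec (Subset 12) 12
  A = row 0 1 1 1 1 0 1 0 1 0 0 0
    ∷ row 1 0 1 1 1 0 0 1 0 1 0 0
    ∷ row 1 1 0 1 0 1 1 0 0 0 1 0
    ∷ row 1 1 1 0 0 1 0 1 0 0 0 1
    ∷ row 1 1 0 0 0 0 0 0 0 0 0 0
    ∷ row 0 0 1 1 0 0 0 0 0 0 0 0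
    ∷ row 1 0 1 0 0 0 0 0 0 0 0 0
    ∷ row 0 1 0 1 0 0 0 0 0 0 0 0
    ∷ row 1 0 0 0 0 0 0 0 0 0 0 0
    ∷ row 0 1 0 0 0 0 0 0 0 0 0 0
    ∷ row 0 0 1 0 0 0 0 0 0 0 0 0
    ∷ row 0 0 0 1 0 0 0 0 0 0 0 0 ∷ []
    where
    row : (a b c d e f g h i j k l : ℕ) → Subset 12
    row a b c d e f g h i j k l =
      mapᵛ (_≡ᵇ 1) (a ∷ b ∷ c ∷ d ∷ e ∷ f ∷ g ∷ h ∷ i ∷ j ∷ k ∷ l ∷ [])

  G₁₂ : Graph 12
  G₁₂ = matrixGraph A (from-yes (all? λ v → lookup (lookup A v) v ≟ᵇ false))
    (from-yes (all? λ u → all? λ v → lookup (lookup A u) v ≟ᵇ lookup (lookup A v) u))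

  connected : Connected G₁₂
  -- Walks of length exactly 3 to and from vertex 0 exist uniformly, since the clique contains
  -- triangles.
  connected u v = 6 , walk-++ G₁₂ (to-0 u) (from-0 v)
    where
    to-0 : ∀ u → Walk G₁₂ u zero 3
    to-0 = from-yes (all? λ u → Walk? G₁₂ u zero 3)
    from-0 : ∀ v → Walk G₁₂ zero v 3
    from-0 = from-yes (all? λ v → Walk? G₁₂ zero v 3)

  split : IsSplit G₁₂
  split = inK₁₂ ,
    from-yes (all? λ u → all? λ v → inK₁₂ u ≟ᵇ true →-dec (inK₁₂ v ≟ᵇ true →-dec (¬? (u ≟ v) →-dec T? (adj G₁₂ u v)))) ,
    from-yes (all? λ u → all? λ v → inK₁₂ u ≟ᵇ false →-dec (inK₁₂ v ≟ᵇ false →-dec ¬? (T? (adj G₁₂ u v))))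
    where
    inK₁₂ : Fin 12 → Bool
    inK₁₂ v = toℕ v <ᵇ 4

  Ds₁₂ Dt₁₂ : Subset 12
  Ds₁₂ = ⁅ # 4 ⁆ ∪ ⁅ # 5 ⁆
  Dt₁₂ = ⁅ # 6 ⁆ ∪ ⁅ # 7 ⁆

  -- The two sets are disjoint of size 2, so the matching bound is 2; two jumps would have to pass
  -- through a set of one source and one target.
  isOpt : IsOpt TJ G₁₂ Ds₁₂ Dt₁₂ 3
  isOpt = from-yes (Seq? TJ G₁₂ Ds₁₂ Dt₁₂ 3) , λ
    { 0 s → contradiction s (from-no (Seq? TJ G₁₂ Ds₁₂ Dt₁₂ 0))
    ; 1 s → contradiction s (from-no (Seq? TJ G₁₂ Ds₁₂ Dt₁₂ 1))
    ; 2 s → contradiction s (from-no (Seq? TJ G₁₂ Ds₁₂ Dt₁₂ 2))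
    ; (suc (suc (suc q))) _ → s≤s (s≤s (s≤s z≤n)) }

-- Assembly of the bounds.

-- Sliding along an optimal matching gives the upper bound and the existence of a sequence; the
-- bijection traced by an optimal sequence gives the lower bound.
sliding-bounds : (G : Graph n) → Connected G → IsSplit G → {d : Fin n → Fin n → ℕ} → IsDistFn G d →
  IsD2DS G D → IsD2DS G Dt → ∣ D ∣ ≡ ∣ Dt ∣ →
  ∃[ m ] ∃[ o ] (IsMStarTS d D Dt m × IsOpt TS G D Dt o × m ≤ o × o ≤ m + 2)
sliding-bounds {D = D} {Dt = Dt} G conn (inK , clique , independent) {d} isd ds dt card
  with m , isM@((f , bij , refl) , m-min) ← IsMStarTS-exists d (proj₂ (IsBij-exists D Dt card))
  with q , q≤ , s ← SplitGraph.Sliding.slide-any conn inK clique independent isd ds dt bij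
  with o , isO@(s' , o-min) ← IsOpt-exists s
  with g , bij' , le ← Distance.Seq-bijection isd s' =
  m , o , isM , isO , ≤-trans (m-min g bij') le , ≤-trans (o-min q s) q≤

jumping-bounds : (G : Graph n) → Connected G → IsSplit G →
  IsD2DS G D → IsD2DS G Dt → ∣ D ∣ ≡ ∣ Dt ∣ →
  ∃[ o ] (IsOpt TJ G D Dt o × MStarTJ D Dt ≤ o × o ≤ MStarTJ D Dt + 1)
jumping-bounds G conn (inK , clique , independent) ds dt card
  with q , q≤ , s ← SplitGraph.jump conn inK clique independent ds dt card
  with o , isO@(s' , o-min) ← IsOpt-exists s =
  o , isO , ≤-trans (/-monoˡ-≤ 2 (symdiff-Seq s')) (≤-reflexive (m*n/n≡m o 2)) , ≤-trans (o-min q s) q≤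

theorem11 : (∀ {n} (G : Graph n) → Connected G → IsSplit G →
    (d : Fin n → Fin n → ℕ) → IsDistFn G d →
    (Ds Dt : Subset n) → IsD2DS G Ds → IsD2DS G Dt → ∣ Ds ∣ ≡ ∣ Dt ∣ →
    (∃[ m ] ∃[ o ] (IsMStarTS d Ds Dt m × IsOpt TS G Ds Dt o × m ≤ o × o ≤ m + 2))
    × (∃[ o ] (IsOpt TJ G Ds Dt o × MStarTJ Ds Dt ≤ o × o ≤ MStarTJ Ds Dt + 1)))
    × (∃[ n ] Σ (Graph n) λ G → Connected G × IsSplit G ×
    Σ (Fin n → Fin n → ℕ) λ d → IsDistFn G d ×
    Σ (Subset n) λ Ds → Σ (Subset n) λ Dt →
    IsD2DS G Ds × IsD2DS G Dt × ∣ Ds ∣ ≡ ∣ Dt ∣ ×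
    ∃[ m ] (IsMStarTS d Ds Dt m × IsOpt TS G Ds Dt (m + 2)))
    × (∃[ n ] Σ (Graph n) λ G → Connected G × IsSplit G ×
    Σ (Subset n) λ Ds → Σ (Subset n) λ Dt →
    IsD2DS G Ds × IsD2DS G Dt × ∣ Ds ∣ ≡ ∣ Dt ∣ ×
    IsOpt TJ G Ds Dt (MStarTJ Ds Dt + 1))
theorem11 =
  (λ G conn split d isd Ds Dt ds dt card →
    sliding-bounds G conn split isd ds dt card , jumping-bounds G conn split ds dt card) ,
  (5 , G₅ , (λ u v → d₅ u v , walks u v) , SlidingExample.split , d₅ , isDist , Ds₅ , Dt₅ ,
   from-yes (IsD2DS? G₅ Ds₅) , from-yes (IsD2DS? G₅ Dt₅) , refl , 2 , isMStar , SlidingExample.isOpt) ,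
  (12 , G₁₂ , connected , JumpingExample.split , Ds₁₂ , Dt₁₂ ,
   from-yes (IsD2DS? G₁₂ Ds₁₂) , from-yes (IsD2DS? G₁₂ Dt₁₂) , refl , JumpingExample.isOpt)
  where
  open SlidingExample hiding (A; split; isOpt)
  open JumpingExample hiding (A; split; isOpt)
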